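{- Let $S$ be (the face semigroup of) an oriented matroid of rank $3$. Then the following are equivalent: $\sigma_1\sigma_2=\sigma_2\sigma_1$; $\sigma_1\sigma_3=\sigma_3\sigma_1$; $\sigma_2\sigma_3=\sigma_3\sigma_2$; $S$ is simplicial.
   Context: The covectors of an oriented matroid form a left regular band under composition $(FG)_e=F_e$ if $F_e\neq 0$ and $G_e$ otherwise, with identity the zero covector. For rank $3$, the nonzero covectors correspond to the cells of a regular cell decomposition of the $2$-sphere (for a central plane arrangement in $\mathbb{R}^3$, the faces intersected with the unit sphere): rank-$1$ faces are vertices, rank-$2$ faces are edges, rank-$3$ faces are chambers (topes). $\sigma_i$ is the sum of all faces of rank $i$ in the semigroup algebra over $\mathbb{Q}$. $S$ is simplicial if every chamber is a triangle. -}

module Defs where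

open import Data.Bool using (Bool; true; false; _∧_; not; if_then_else_)
open import Data.Nat using (ℕ; zero; suc; _⊔_; _≡ᵇ_)
open import Data.Fin using (Fin)
open import Data.Vec using (Vec; []; _∷_; lookup; zipWith; map)
open import Data.List using (List; []; _∷_; filter; foldr; length; concatMap)
import Data.List as List
open import Data.Product using (Σ; _×_; _,_)
open import Data.Rational using (ℚ; 0ℚ; 1ℚ; _+_; _*_)
open import Relation.Binary.PropositionalEquality using (_≡_)
open import Relation.Nullary.Decidable using (T?)

data Sign : Set where
  pos neg zer : Sign

SV : ℕ → Set
SV n = Vec Sign n

opp : Sign → Sign
opp pos = neg
opp neg = pos
opp zer = zer

compS : Sign → Sign → Sign
compS zer b = b
compS a   _ = a

negV : ∀ {n} → SV n → SV n
negV = map opp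

_∘ᵥ_ : ∀ {n} → SV n → SV n → SV n
X ∘ᵥ Y = zipWith compS X Y

zeroV : ∀ {n} → SV n
zeroV {zero}  = []
zeroV {suc n} = zer ∷ zeroV

sepS : Sign → Sign → Bool
sepS pos neg = true
sepS neg pos = true
sepS _   _   = false

eqS : Sign → Sign → Bool
eqS pos pos = true
eqS neg neg = true
eqS zer zer = true
eqS _   _   = false

isZer : Sign → Bool
isZer zer = true
isZer _   = false

_==ᵥ_ : ∀ {n} → SV n → SV n → Bool
[] ==ᵥ [] = true
(a ∷ X) ==ᵥ (b ∷ Y) = eqS a b ∧ (X ==ᵥ Y)

_≤ᵥ_ : ∀ {n} → SV n → SV n → Bool
[] ≤ᵥ [] = true
(a ∷ X) ≤ᵥ (b ∷ Y) = (isZer a Data.Bool.∨ eqS a b) ∧ (X ≤ᵥ Y)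

_<ᵥ_ : ∀ {n} → SV n → SV n → Bool
X <ᵥ Y = (X ≤ᵥ Y) ∧ not (X ==ᵥ Y)

allSV : (n : ℕ) → List (SV n)
allSV zero    = [] ∷ []
allSV (suc n) = concatMap (λ v → (pos ∷ v) ∷ (neg ∷ v) ∷ (zer ∷ v) ∷ []) (allSV n)

-- Oriented matroids, given by their set of covectors
-- (covector axioms of Björner–Las Vergnas–Sturmfels–White–Ziegler).
-- The covector set is a (decidable) subset L of {+,-,0}^E.

record OrientedMatroid (n : ℕ) : Set where
  field
    L   : SV n → Bool
    V0  : L zeroV ≡ true
    V1  : ∀ X → L X ≡ true → L (negV X) ≡ true
    V2  : ∀ X Y → L X ≡ true → L Y ≡ true → L (X ∘ᵥ Y) ≡ true
    V3  : ∀ X Y → L X ≡ true → L Y ≡ true → (e : Fin n) →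
          sepS (lookup X e) (lookup Y e) ≡ true →
          Σ (SV n) λ Z → (L Z ≡ true) × (lookup Z e ≡ zer) ×
            (∀ f → sepS (lookup X f) (lookup Y f) ≡ false →
                   lookup Z f ≡ lookup (X ∘ᵥ Y) f)
open OrientedMatroid public

-- Rank of a covector: the length of a longest chain 0 = X₀ < X₁ < ... < Xₖ = X
-- of covectors (in the face order). Computed by recursion with fuel; since the
-- support strictly increases along a chain, chains have length ≤ n, so fuel
-- suc n is always sufficient and rankF (suc n) is the exact longest-chain length.

rankF : ∀ {n} → ℕ → (SV n → Bool) → SV n → ℕ
rankF zero    L X = 0
rankF {n} (suc k) L X =
  foldr _⊔_ 0 (List.map (λ Y → suc (rankF k L Y))
                        (filter (λ Y → T? (L Y ∧ (Y <ᵥ X))) (allSV n)))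

rank : ∀ {n} → OrientedMatroid n → SV n → ℕ
rank {n} M X = rankF (suc n) (L M) X

-- M has rank r: every covector has rank ≤ r and some covector has rank r
-- (equivalently, the topes have rank r).
HasRank : ∀ {n} → OrientedMatroid n → ℕ → Set
HasRank {n} M r =
  (Σ (SV n) λ X → (L M X ≡ true) × (rank M X ≡ r)) ×
  (∀ X → L M X ≡ true → rank M X Data.Nat.≤ r)

-- The semigroup algebra ℚ[{+,-,0}^E] of the composition monoid of all sign
-- vectors; the face semigroup algebra ℚL is the subalgebra of elements
-- supported on L. Elements are functions (coefficient of each sign vector).

Alg : ℕ → Set
Alg n = SV n → ℚ

sumℚ : List ℚ → ℚ
sumℚ = foldr _+_ 0ℚ

_·_ : ∀ {n} → Alg n → Alg n → Alg n
_·_ {n} a b Z =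
  sumℚ (concatMap (λ X → List.map (λ Y →
           if (X ∘ᵥ Y) ==ᵥ Z then a X * b Y else 0ℚ) (allSV n)) (allSV n))

σ : ∀ {n} → OrientedMatroid n → ℕ → Alg n
σ M i X = if L M X ∧ (rank M X ≡ᵇ i) then 1ℚ else 0ℚ

_≈ₐ_ : ∀ {n} → Alg n → Alg n → Set
a ≈ₐ b = ∀ Z → a Z ≡ b Z

numVertices : ∀ {n} → OrientedMatroid n → SV n → ℕ
numVertices {n} M T =
  length (filter (λ X → T? (L M X ∧ (rank M X ≡ᵇ 1) ∧ (X ≤ᵥ T))) (allSV n))

Simplicial : ∀ {n} → OrientedMatroid n → Set
Simplicial {n} M = ∀ T → L M T ≡ true → rank M T ≡ 3 → numVertices M T ≡ 3

{-# OPTIONS --safe #-}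
module Submission where

-- For a covector X, the identity  Σ (-1)^rank(F) F ∘ X = Σ (-1)^rank(G) G  in the semigroup algebra
-- (F over all covectors, G over the covectors above − X) follows by moving X through facets towards
-- − G. Summing coefficients over suitable sets of G gives all the Euler relations that are needed:
-- for the sphere, for the great circles, for intervals of faces. Multiplying by σ₁, σ₂, σ₃ expresses
-- σ₁σ₂ and σ₁σ₃ by the products σ₂σⱼ, and the coefficient of a tope D in σ₂σⱼ is found from the
-- involution Y ↦ − Y. Twice the coefficient of each of the three
-- commutators at D is  k f₃ − 2 f₂ , where k is the number of edges of D and fᵢ the number of faces
-- of rank i; outside the topes the commutators vanish. Hence commutation says that all topes have
-- the average number of edges, which is less than 4 by Euler's formula as all vertices have degree
-- at least 4.

open import Defs
open import Data.Bool using (Bool; true; false; not; if_then_else_; T; _∧_; _∨_)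
import Data.Bool.Properties as 𝔹
open import Data.Empty using (⊥)
open import Data.Fin using (Fin; zero; suc)
open import Data.Fin.Properties using (any?)
open import Data.Integer using (ℤ; 0ℤ; 1ℤ; -1ℤ; _+_; _*_; _-_; _≤_)
import Data.Integer as ℤ
import Data.Integer.Properties as ℤₚ
open import Data.Integer.Tactic.RingSolver using (solve-∀)
open import Data.List using (List; []; _∷_; foldr; filter; concatMap; length)
import Data.List as List
open import Data.List.Membership.Propositional using (_∈_; lose; find)
open import Data.List.Membership.Propositional.Properties
  using (∈-concatMap⁺; ∈-map⁺; ∈-map⁻; ∈-filter⁺; ∈-filter⁻; foldr-selective)
open import Data.List.Relation.Unary.Any using (here; there)
import Data.List.Relation.Unary.Any as Any
open import Data.Nat using (ℕ; zero; suc; _<_; _⊔_; z≤n; s≤s; s≤s⁻¹)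
import Data.Nat as ℕ
import Data.Nat.Coprimality as Coprimality
import Data.Nat.Properties as ℕₚ
open import Data.Product using (∃; _×_; _,_; proj₁; proj₂)
open import Data.Rational using (ℚ; mkℚ; 0ℚ; 1ℚ; ↥_)
import Data.Rational as ℚ
import Data.Rational.Properties as ℚₚ
import Data.Rational.Unnormalised as ℚᵘ
import Data.Rational.Unnormalised.Properties as ℚᵘₚ
open import Data.Sum using (_⊎_; inj₁; inj₂; map₂)
open import Data.Vec using (Vec; []; _∷_; lookup; zipWith)
import Data.Vec as Vec
open import Data.Vec.Properties
  using (lookup-map; lookup-zipWith; ≡-dec; ∷-injectiveˡ; ∷-injectiveʳ)
open import Function using (_∘_; id)
open import Function.Bundles using (Equivalence; _⇔_; mk⇔)
open import Function.Construct.Composition using (_⇔-∘_)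
open import Relation.Binary.PropositionalEquality
open import Relation.Nullary using (¬_; Dec; does; yes; no; contradiction)
open import Relation.Nullary.Decidable
  using (map′; ¬?; _×-dec_; _→-dec_; isYes≗does; toWitness; fromWitness; True; T?; decidable-stable)

-- The definitions give the rank as the length of a longest chain, whereas moving through facets
-- needs two facts: covectors with equal support have equal rank, and a facet of `X` has rank
-- exactly one less than `X`. Both are derived from elimination, through semimodularity of the order
-- of supports. One trichotomy then serves twice. Relative to a facet `H` of `X`, a covector
-- supported in `X` lies on `H`, on the side of `X`, or on the opposite side. It controls which
-- terms are lost when `X` crosses `H`, and it evaluates the coefficients of σ₂σⱼ, where the faces
-- on neither side of an edge are those on its great circle. Such a circle has as many vertices as
-- edges and contains no tope, which is why the different commutators lead to the same number. Sums
-- range over all sign vectors, with indicator weights that vanish off the faces in question, and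
-- stay in ℤ until the final comparison with ℚ.

private variable n k : ℕ

-- Sign vectors and a decision procedure for their quasi-identities

_≟ₛ_ : (a b : Sign) → Dec (a ≡ b)
pos ≟ₛ pos = yes refl
pos ≟ₛ neg = no λ ()
pos ≟ₛ zer = no λ ()
neg ≟ₛ pos = no λ ()
neg ≟ₛ neg = yes refl
neg ≟ₛ zer = no λ ()
zer ≟ₛ pos = no λ ()
zer ≟ₛ neg = no λ ()
zer ≟ₛ zer = yes refl

_≟_ : (X Y : SV n) → Dec (X ≡ Y)
_≟_ = ≡-dec _≟ₛ_

-- With its arguments exchanged in `_∣ᵥ_`, this restricts a sign vector to the support of another
-- one; it is applied to a target `G` and a facet `H`.
resS : Sign → Sign → Sign
resS zer _ = zer
resS _   b = b

-- The signs on which elimination leaves no freedom: the composition off the separation set, and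
-- zero on it.
agreeS : Sign → Sign → Sign
agreeS a b = if sepS a b then zer else compS a b

data Term (k : ℕ) : Set where
  var           : Fin k → Term k
  𝟎             : Term k
  ⊖_            : Term k → Term k
  _∙_ _∣_ _⊓_   : Term k → Term k → Term k

infixl 7 _∙_ _∣_ _⊓_
infix  8 ⊖_

⟦_⟧ₛ : Term k → Vec Sign k → Sign
⟦ var i ⟧ₛ ρ = lookup ρ i
⟦ 𝟎     ⟧ₛ ρ = zer
⟦ ⊖ t   ⟧ₛ ρ = opp (⟦ t ⟧ₛ ρ)
⟦ t ∙ s ⟧ₛ ρ = compS (⟦ t ⟧ₛ ρ) (⟦ s ⟧ₛ ρ)
⟦ t ∣ s ⟧ₛ ρ = resS (⟦ s ⟧ₛ ρ) (⟦ t ⟧ₛ ρ)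
⟦ t ⊓ s ⟧ₛ ρ = agreeS (⟦ t ⟧ₛ ρ) (⟦ s ⟧ₛ ρ)

_∣ᵥ_ _⊓ᵥ_ : SV n → SV n → SV n
X ∣ᵥ Y = zipWith resS Y X
X ⊓ᵥ Y = zipWith agreeS X Y

⟦_⟧ : Term k → Vec (SV n) k → SV n
⟦ var i ⟧ ρ = lookup ρ i
⟦ 𝟎     ⟧ ρ = zeroV
⟦ ⊖ t   ⟧ ρ = negV (⟦ t ⟧ ρ)
⟦ t ∙ s ⟧ ρ = ⟦ t ⟧ ρ ∘ᵥ ⟦ s ⟧ ρ
⟦ t ∣ s ⟧ ρ = ⟦ t ⟧ ρ ∣ᵥ ⟦ s ⟧ ρ
⟦ t ⊓ s ⟧ ρ = ⟦ t ⟧ ρ ⊓ᵥ ⟦ s ⟧ ρ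

lookup-zeroV : (e : Fin n) → lookup zeroV e ≡ zer
lookup-zeroV zero    = refl
lookup-zeroV (suc e) = lookup-zeroV e

ext : {X Y : SV n} → (∀ e → lookup X e ≡ lookup Y e) → X ≡ Y
ext {X = []}    {[]}    _ = refl
ext {X = x ∷ X} {y ∷ Y} p = cong₂ _∷_ (p zero) (ext (p ∘ suc))

column : Vec (SV n) k → Fin n → Vec Sign k
column ρ e = Vec.map (λ X → lookup X e) ρ

lookup-⟦⟧ : (t : Term k) (ρ : Vec (SV n) k) (e : Fin n) →
            lookup (⟦ t ⟧ ρ) e ≡ ⟦ t ⟧ₛ (column ρ e)
lookup-⟦⟧ (var i) ρ e = sym (lookup-map i _ ρ)
lookup-⟦⟧ 𝟎       ρ e = lookup-zeroV e
lookup-⟦⟧ (⊖ t)   ρ e = trans (lookup-map e opp (⟦ t ⟧ ρ)) (cong opp (lookup-⟦⟧ t ρ e))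
lookup-⟦⟧ (t ∙ s) ρ e = trans (lookup-zipWith compS e (⟦ t ⟧ ρ) (⟦ s ⟧ ρ))
  (cong₂ compS (lookup-⟦⟧ t ρ e) (lookup-⟦⟧ s ρ e))
lookup-⟦⟧ (t ∣ s) ρ e = trans (lookup-zipWith resS e (⟦ s ⟧ ρ) (⟦ t ⟧ ρ))
  (cong₂ resS (lookup-⟦⟧ s ρ e) (lookup-⟦⟧ t ρ e))
lookup-⟦⟧ (t ⊓ s) ρ e = trans (lookup-zipWith agreeS e (⟦ t ⟧ ρ) (⟦ s ⟧ ρ))
  (cong₂ agreeS (lookup-⟦⟧ t ρ e) (lookup-⟦⟧ s ρ e))

infix 6 _≈_
record Equation (k : ℕ) : Set where
  constructor _≈_
  field lhs rhs : Term k

Holdsₛ : Vec Sign k → Equation k → Set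
Holdsₛ ρ (t ≈ s) = ⟦ t ⟧ₛ ρ ≡ ⟦ s ⟧ₛ ρ

Holds : Vec (SV n) k → Equation k → Set
Holds ρ (t ≈ s) = ⟦ t ⟧ ρ ≡ ⟦ s ⟧ ρ

Premises : (Equation k → Set) → List (Equation k) → Set → Set
Premises H []      C = C
Premises H (E ∷ Γ) C = H E → Premises H Γ C

Validₛ : List (Equation k) → Equation k → Vec Sign k → Set
Validₛ Γ E ρ = Premises (Holdsₛ ρ) Γ (Holdsₛ ρ E)

validₛ? : (Γ : List (Equation k)) (E : Equation k) (ρ : Vec Sign k) → Dec (Validₛ Γ E ρ)
validₛ? []            (t ≈ s) ρ = ⟦ t ⟧ₛ ρ ≟ₛ ⟦ s ⟧ₛ ρ
validₛ? ((t ≈ s) ∷ Γ) E       ρ = (⟦ t ⟧ₛ ρ ≟ₛ ⟦ s ⟧ₛ ρ) →-dec validₛ? Γ E ρ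

allSigns? : ∀ k {P : Vec Sign k → Set} → (∀ ρ → Dec (P ρ)) → Dec (∀ ρ → P ρ)
allSigns? zero    P? = map′ (λ { p [] → p }) (λ p → p []) (P? [])
allSigns? (suc k) P? =
  map′ (λ { (p , q , r) (pos ∷ ρ) → p ρ ; (p , q , r) (neg ∷ ρ) → q ρ ; (p , q , r) (zer ∷ ρ) → r ρ })
       (λ p → (λ ρ → p (pos ∷ ρ)) , (λ ρ → p (neg ∷ ρ)) , (λ ρ → p (zer ∷ ρ)))
       (allSigns? k (λ ρ → P? (pos ∷ ρ)) ×-dec allSigns? k (λ ρ → P? (neg ∷ ρ))
         ×-dec allSigns? k (λ ρ → P? (zer ∷ ρ)))

-- A quasi-identity between sign vectors holds as soon as it holds for single signs, which is
-- checked by evaluation.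
by-signs : (ρ : Vec (SV n) k) (Γ : List (Equation k)) (E : Equation k)
           {_ : True (allSigns? k (validₛ? Γ E))} → Premises (Holds ρ) Γ (Holds ρ E)
by-signs {n = n} ρ Γ (t ≈ s) {valid} = collect Γ λ e → toWitness valid (column ρ e)
  where
  at : (t s : Term _) (e : Fin n) → ⟦ t ⟧ ρ ≡ ⟦ s ⟧ ρ → ⟦ t ⟧ₛ (column ρ e) ≡ ⟦ s ⟧ₛ (column ρ e)
  at t s e eq = trans (sym (lookup-⟦⟧ t ρ e)) (trans (cong (λ X → lookup X e) eq) (lookup-⟦⟧ s ρ e))

  collect : ∀ Γ → (∀ e → Validₛ Γ (t ≈ s) (column ρ e)) → Premises (Holds ρ) Γ (⟦ t ⟧ ρ ≡ ⟦ s ⟧ ρ)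
  collect []            v = ext λ e → trans (lookup-⟦⟧ t ρ e) (trans (v e) (sym (lookup-⟦⟧ s ρ e)))
  collect ((a ≈ b) ∷ Γ) v = λ eq → collect Γ λ e → v e (at a b e eq)

x₀ : Term (suc k)
x₀ = var zero
x₁ : Term (suc (suc k))
x₁ = var (suc zero)
x₂ : Term (suc (suc (suc k)))
x₂ = var (suc (suc zero))
x₃ : Term (suc (suc (suc (suc k))))
x₃ = var (suc (suc (suc zero)))

infix 4 _≼_ _⊑_ _≼?_ _⊑?_

-- The face order and the inclusion of supports, in terms of the composition.
_≼_ _⊑_ : SV n → SV n → Set
X ≼ Y = X ∘ᵥ Y ≡ Y
X ⊑ Y = Y ∘ᵥ X ≡ Y

_≼?_ : (X Y : SV n) → Dec (X ≼ Y)
X ≼? Y = (X ∘ᵥ Y) ≟ Y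

_⊑?_ : (X Y : SV n) → Dec (X ⊑ Y)
X ⊑? Y = (Y ∘ᵥ X) ≟ Y

infix 6 _≼ₜ_ _⊑ₜ_
_≼ₜ_ _⊑ₜ_ : Term k → Term k → Equation k
s ≼ₜ t = s ∙ t ≈ t
s ⊑ₜ t = t ∙ s ≈ t

≼-refl : {X : SV n} → X ≼ X
≼-refl {X = X} = by-signs (X ∷ []) [] (x₀ ≼ₜ x₀)

≼-trans : {X Y Z : SV n} → X ≼ Y → Y ≼ Z → X ≼ Z
≼-trans {X = X} {Y} {Z} = by-signs (X ∷ Y ∷ Z ∷ []) (x₀ ≼ₜ x₁ ∷ x₁ ≼ₜ x₂ ∷ []) (x₀ ≼ₜ x₂)

≼-antisym : {X Y : SV n} → X ≼ Y → Y ≼ X → X ≡ Y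
≼-antisym {X = X} {Y} = by-signs (X ∷ Y ∷ []) (x₀ ≼ₜ x₁ ∷ x₁ ≼ₜ x₀ ∷ []) (x₀ ≈ x₁)

≼⇒⊑ : {X Y : SV n} → X ≼ Y → X ⊑ Y
≼⇒⊑ {X = X} {Y} = by-signs (X ∷ Y ∷ []) (x₀ ≼ₜ x₁ ∷ []) (x₀ ⊑ₜ x₁)

⊑-trans : {X Y Z : SV n} → X ⊑ Y → Y ⊑ Z → X ⊑ Z
⊑-trans {X = X} {Y} {Z} = by-signs (X ∷ Y ∷ Z ∷ []) (x₀ ⊑ₜ x₁ ∷ x₁ ⊑ₜ x₂ ∷ []) (x₀ ⊑ₜ x₂)

≼-⊑-antisym : {X Y : SV n} → X ≼ Y → Y ⊑ X → X ≡ Y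
≼-⊑-antisym {X = X} {Y} = by-signs (X ∷ Y ∷ []) (x₀ ≼ₜ x₁ ∷ x₁ ⊑ₜ x₀ ∷ []) (x₀ ≈ x₁)

x≼x∘y : (X Y : SV n) → X ≼ (X ∘ᵥ Y)
x≼x∘y X Y = by-signs (X ∷ Y ∷ []) [] (x₀ ≼ₜ x₀ ∙ x₁)

0≼ : (X : SV n) → zeroV ≼ X
0≼ X = by-signs (X ∷ []) [] (𝟎 ≼ₜ x₀)

neg-involutive : (X : SV n) → negV (negV X) ≡ X
neg-involutive X = by-signs (X ∷ []) [] (⊖ ⊖ x₀ ≈ x₀)

-- Enumeration of sign vectors, and the measures for the inductions

∈-allSV : (X : SV n) → X ∈ allSV n
∈-allSV []      = here refl
∈-allSV (x ∷ X) = ∈-concatMap⁺ _ (Any.map (λ { refl → ∈-signs x }) (∈-allSV X))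
  where
  ∈-signs : ∀ x → (x ∷ X) ∈ ((pos ∷ X) ∷ (neg ∷ X) ∷ (zer ∷ X) ∷ [])
  ∈-signs pos = here refl
  ∈-signs neg = there (here refl)
  ∈-signs zer = there (there (here refl))

anySV? : {P : SV n → Set} → (∀ X → Dec (P X)) → Dec (∃ P)
anySV? {n = n} P? = map′ (λ a → let (X , _ , p) = find a in X , p)
  (λ (X , p) → lose (∈-allSV X) p) (Any.any? P? (allSV n))

count : (Fin n → Bool) → ℕ
count {zero}  b = 0
count {suc n} b = (if b zero then 1 else 0) ℕ.+ count (b ∘ suc)

count-≤ : (b : Fin n → Bool) → count b ℕ.≤ n
count-≤ {zero}  b = z≤n
count-≤ {suc n} b with b zero
... | true  = s≤s (count-≤ (b ∘ suc))
... | false = ℕₚ.m≤n⇒m≤1+n (count-≤ (b ∘ suc))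

count-mono : {b c : Fin n → Bool} → (∀ e → b e ≡ true → c e ≡ true) → count b ℕ.≤ count c
count-mono {zero}          b⊆c = z≤n
count-mono {suc n} {b} {c} b⊆c with b zero in p | c zero in q
... | false | false = count-mono (λ e → b⊆c (suc e))
... | false | true  = ℕₚ.m≤n⇒m≤1+n (count-mono (λ e → b⊆c (suc e)))
... | true  | true  = s≤s (count-mono (λ e → b⊆c (suc e)))
... | true  | false = contradiction (trans (sym q) (b⊆c zero p)) λ ()

count-mono-< : {b c : Fin n → Bool} → (∀ e → b e ≡ true → c e ≡ true) →
               (e : Fin n) → b e ≡ false → c e ≡ true → count b < count c
count-mono-< {b = b} {c} b⊆c zero be ce rewrite be | ce = s≤s (count-mono (λ e → b⊆c (suc e)))
count-mono-< {suc n} {b} {c} b⊆c (suc e) be ce with b zero in p | c zero in q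
... | false | false = count-mono-< (λ e → b⊆c (suc e)) e be ce
... | false | true  = ℕₚ.m<n⇒m<1+n (count-mono-< (λ e → b⊆c (suc e)) e be ce)
... | true  | true  = s≤s (count-mono-< (λ e → b⊆c (suc e)) e be ce)
... | true  | false = contradiction (trans (sym q) (b⊆c zero p)) λ ()

size : SV n → ℕ
size X = count λ e → not (isZer (lookup X e))

separation : SV n → SV n → ℕ
separation X Y = count λ e → sepS (lookup X e) (lookup Y e)

size-≤ : {X Y : SV n} → X ⊑ Y → size X ℕ.≤ size Y
size-≤ {X = X} {Y} p = count-mono λ e → signs _ _
  (trans (sym (lookup-zipWith compS e Y X)) (cong (λ Z → lookup Z e) p))
  where
  signs : ∀ x y → compS y x ≡ y → not (isZer x) ≡ true → not (isZer y) ≡ true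
  signs x pos _ _ = refl
  signs x neg _ _ = refl
  signs x zer refl ()

differ : {X Y : SV n} → X ≢ Y → ∃ λ e → lookup X e ≢ lookup Y e
differ {X = X} {Y} X≢Y with any? (λ e → ¬? (lookup X e ≟ₛ lookup Y e))
... | yes p = p
... | no ¬p = contradiction (ext λ e → decidable-stable (_ ≟ₛ _) (λ q → ¬p (e , q))) X≢Y

at : {X Y : SV n} → X ≡ Y → ∀ e → lookup X e ≡ lookup Y e
at p e = cong (λ Z → lookup Z e) p

size-< : {X Y : SV n} → X ≼ Y → X ≢ Y → size X < size Y
size-< {X = X} {Y} X≼Y X≢Y = let (e , p) = differ X≢Y in
  count-mono-< (λ f → mono _ _ (pw f)) e (zero-at _ _ (pw e) p) (nonzero-at _ _ (pw e) p)
  where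
  pw : ∀ e → compS (lookup X e) (lookup Y e) ≡ lookup Y e
  pw e = trans (sym (lookup-zipWith compS e X Y)) (at X≼Y e)

  mono : ∀ x y → compS x y ≡ y → not (isZer x) ≡ true → not (isZer y) ≡ true
  mono pos pos _ _ = refl
  mono neg neg _ _ = refl

  zero-at : ∀ x y → compS x y ≡ y → x ≢ y → not (isZer x) ≡ false
  zero-at pos y p q = contradiction p q
  zero-at neg y p q = contradiction p q
  zero-at zer y p q = refl

  nonzero-at : ∀ x y → compS x y ≡ y → x ≢ y → not (isZer y) ≡ true
  nonzero-at x   pos p q = refl
  nonzero-at x   neg p q = refl
  nonzero-at zer zer p q = contradiction refl q

pointwise : (f : Sign → Sign → Sign) {X Y Z : SV n} → zipWith f X Y ≡ Z →
            ∀ e → f (lookup X e) (lookup Y e) ≡ lookup Z e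
pointwise f {X} {Y} p e = trans (sym (lookup-zipWith f e X Y)) (at p e)

separated : {X W : SV n} → W ⊑ X → ¬ W ≼ X → ∃ λ e → sepS (lookup X e) (lookup W e) ≡ true
separated {X = X} {W} W⊑X W⋠X = let (e , p) = differ W⋠X in
  e , signs _ _ (pointwise compS W⊑X e) (p ∘ trans (lookup-zipWith compS e W X))
  where
  signs : ∀ x w → compS x w ≡ x → compS w x ≢ x → sepS x w ≡ true
  signs pos pos _ q = contradiction refl q
  signs pos neg _ _ = refl
  signs pos zer _ q = contradiction refl q
  signs neg pos _ _ = refl
  signs neg neg _ q = contradiction refl q
  signs neg zer _ q = contradiction refl q
  signs zer zer _ q = contradiction refl q

-- Where `X` is nonzero and not opposed by `W`, the lower bound forces `Z` to equal `X`. So no new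
-- separating element appears, and `e` disappears.
separation-< : {X W Z : SV n} → (X ⊓ᵥ W) ≼ Z → ∀ e → sepS (lookup X e) (lookup W e) ≡ true →
               lookup Z e ≡ zer → separation X Z < separation X W
separation-< {X = X} {W} {Z} low e sep Ze =
  count-mono-< (λ f → shrink _ _ _ (trans (cong (λ s → compS s (lookup Z f))
    (sym (lookup-zipWith agreeS f X W))) (pointwise compS low f)))
    e (trans (cong (sepS (lookup X e)) Ze) (sep-zer (lookup X e))) sep
  where
  sep-zer : ∀ x → sepS x zer ≡ false
  sep-zer pos = refl
  sep-zer neg = refl
  sep-zer zer = refl

  shrink : ∀ x w z → compS (agreeS x w) z ≡ z → sepS x z ≡ true → sepS x w ≡ true
  shrink pos neg z   _ _ = refl
  shrink neg pos z   _ _ = refl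
  shrink pos pos pos _ ()
  shrink pos zer pos _ ()
  shrink neg neg neg _ ()
  shrink neg zer neg _ ()

-- Covectors: elimination and facets

module Covectors {n : ℕ} (M : OrientedMatroid n) where

  Cov : SV n → Set
  Cov X = L M X ≡ true

  cov? : ∀ X → Dec (Cov X)
  cov? X = L M X 𝔹.≟ true

  cov-neg : ∀ {X} → Cov X → Cov (negV X)
  cov-neg = V1 M _

  cov-∘ : ∀ {X Y} → Cov X → Cov Y → Cov (X ∘ᵥ Y)
  cov-∘ = V2 M _ _

  -- Axiom `V3` in equational form, so that `by-signs` can use it: the prescribed nonzero signs
  -- become a lower bound for `Z`, the prescribed zeros a bound on its support.
  eliminate : ∀ {X Y} → Cov X → Cov Y → (e : Fin n) → sepS (lookup X e) (lookup Y e) ≡ true →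
              ∃ λ Z → Cov Z × (lookup Z e ≡ zer) × (X ⊓ᵥ Y) ≼ Z × Z ⊑ (X ∘ᵥ Y)
  eliminate {X} {Y} cX cY e sep = let (Z , cZ , Ze , off) = V3 M X Y cX cY e sep in
    Z , cZ , Ze ,
    ext (λ f → trans (trans (lookup-zipWith compS f (X ⊓ᵥ Y) Z)
                 (cong (λ s → compS s (lookup Z f)) (lookup-zipWith agreeS f X Y)))
               (agree _ _ _ λ s → trans (off f s) (lookup-zipWith compS f X Y))) ,
    ext (λ f → trans (trans (lookup-zipWith compS f (X ∘ᵥ Y) Z)
                 (cong (λ s → compS s (lookup Z f)) (lookup-zipWith compS f X Y)))
               (trans (support _ _ _ λ s → trans (off f s) (lookup-zipWith compS f X Y))
                 (sym (lookup-zipWith compS f X Y))))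
    where
    agree : ∀ x y z → (sepS x y ≡ false → z ≡ compS x y) → compS (agreeS x y) z ≡ z
    agree pos pos z p rewrite p refl = refl
    agree pos neg z p = refl
    agree pos zer z p rewrite p refl = refl
    agree neg pos z p = refl
    agree neg neg z p rewrite p refl = refl
    agree neg zer z p rewrite p refl = refl
    agree zer y   z p rewrite p refl with y
    ... | pos = refl
    ... | neg = refl
    ... | zer = refl

    support : ∀ x y z → (sepS x y ≡ false → z ≡ compS x y) → compS (compS x y) z ≡ compS x y
    support pos y   z p = refl
    support neg y   z p = refl
    support zer pos z p = refl
    support zer neg z p = refl
    support zer zer z p = p refl

  -- Moving from X towards W, the first face of X that is met.
  first-face : ∀ d {X W} → separation X W < d → Cov X → Cov W → W ⊑ X → ¬ W ≼ X →
               ∃ λ Z → Cov Z × Z ≼ X × Z ≢ X × Z ∘ᵥ W ≡ Z ∘ᵥ negV X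
  first-face zero    ()
  first-face (suc d) {X} {W} <d cX cW W⊑X W⋠X
    with e , sep ← separated W⊑X W⋠X
    with Z , cZ , Ze , low , up ← eliminate cX cW e sep
    with Z ≼? X
  ... | yes Z≼X = Z , cZ , Z≼X , (λ { refl → nonzero Ze sep }) ,
    by-signs (X ∷ W ∷ Z ∷ []) (x₀ ⊓ x₁ ≼ₜ x₂ ∷ x₂ ≼ₜ x₀ ∷ x₁ ⊑ₜ x₀ ∷ []) (x₂ ∙ x₁ ≈ x₂ ∙ ⊖ x₀)
      low Z≼X W⊑X
    where
    nonzero : ∀ {x w} → x ≡ zer → sepS x w ≢ true
    nonzero refl ()
  -- `Z` is nearer to `X` than `W` was, so the recursion goes from `X` towards `Z`. Its result
  -- carries over to `W`: where `Z` is opposite to `X`, so is `W`, because `Z` keeps every sign of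
  -- `X` that `W` does not oppose.
  ... | no  Z⋠X =
    let (U , cU , U≼X , U≢X , p) = first-face d
          (ℕₚ.<-≤-trans (separation-< low e sep Ze) (s≤s⁻¹ <d)) cX cZ
          (by-signs (X ∷ W ∷ Z ∷ []) (x₁ ⊑ₜ x₀ ∷ x₂ ⊑ₜ x₀ ∙ x₁ ∷ []) (x₂ ⊑ₜ x₀) W⊑X up) Z⋠X
    in U , cU , U≼X , U≢X ,
      by-signs (X ∷ W ∷ Z ∷ U ∷ [])
        (x₀ ⊓ x₁ ≼ₜ x₂ ∷ x₃ ≼ₜ x₀ ∷ x₁ ⊑ₜ x₀ ∷ x₃ ∙ x₂ ≈ x₃ ∙ ⊖ x₀ ∷ []) (x₃ ∙ x₁ ≈ x₃ ∙ ⊖ x₀)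
        low U≼X W⊑X p

  record _⋖_ (H X : SV n) : Set where
    field
      cov     : Cov H
      below   : H ≼ X
      proper  : H ≢ X
      maximal : ∀ {U} → Cov U → H ≼ U → U ≼ X → U ≡ H ⊎ U ≡ X

  coatom-above : ∀ d {Z X} → size X ℕ.∸ size Z < d → Cov Z → Z ≼ X → Z ≢ X →
                 ∃ λ H → H ⋖ X × Z ≼ H
  coatom-above zero    ()
  coatom-above (suc d) {Z} {X} <d cZ Z≼X Z≢X
    with anySV? (λ U → cov? U ×-dec Z ≼? U ×-dec U ≼? X ×-dec ¬? (U ≟ Z) ×-dec ¬? (U ≟ X))
  ... | yes (U , cU , Z≼U , U≼X , U≢Z , U≢X) =
    let (H , H⋖X , U≼H) = coatom-above d
          (ℕₚ.<-≤-trans (ℕₚ.∸-monoʳ-< (size-< Z≼U (U≢Z ∘ sym)) (size-≤ (≼⇒⊑ U≼X))) (s≤s⁻¹ <d))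
          cU U≼X U≢X
    in H , H⋖X , ≼-trans Z≼U U≼H
  ... | no none = Z , record
    { cov = cZ ; below = Z≼X ; proper = Z≢X
    ; maximal = λ {U} cU Z≼U U≼X → dichotomy U cU Z≼U U≼X (U ≟ Z) (U ≟ X) } , ≼-refl
    where
    dichotomy : ∀ U → Cov U → Z ≼ U → U ≼ X → Dec (U ≡ Z) → Dec (U ≡ X) → U ≡ Z ⊎ U ≡ X
    dichotomy U cU a b (yes p) _       = inj₁ p
    dichotomy U cU a b _       (yes q) = inj₂ q
    dichotomy U cU a b (no p)  (no q)  = contradiction (U , cU , a , b , p , q) none

  -- If `H ∘ᵥ W` is a face of `X`, maximality of `H` leaves only `H` and `X`. Otherwise the first
  -- face of `X` met on the way to `H ∘ᵥ W` must contain `H`, hence is `H`, and outside its support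
  -- `W` is opposite to `X`.
  facet-sides : ∀ {H X W} → Cov X → H ⋖ X → Cov W → W ⊑ X →
                H ∘ᵥ W ≡ H ⊎ H ∘ᵥ W ≡ X ⊎ H ∘ᵥ W ≡ H ∘ᵥ negV X
  facet-sides {H} {X} {W} cX H⋖X cW W⊑X with (H ∘ᵥ W) ≼? X
  ... | yes U≼X with _⋖_.maximal H⋖X (cov-∘ (_⋖_.cov H⋖X) cW) (x≼x∘y H W) U≼X
  ...   | inj₁ p = inj₁ p
  ...   | inj₂ p = inj₂ (inj₁ p)
  facet-sides {H} {X} {W} cX H⋖X cW W⊑X | no U⋠X
    with Z , cZ , Z≼X , Z≢X , p ← first-face _ ℕₚ.≤-refl cX (cov-∘ (_⋖_.cov H⋖X) cW)
      (by-signs (H ∷ X ∷ W ∷ []) (x₀ ≼ₜ x₁ ∷ x₂ ⊑ₜ x₁ ∷ []) (x₀ ∙ x₂ ⊑ₜ x₁) (_⋖_.below H⋖X) W⊑X) U⋠X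
    with _⋖_.maximal H⋖X cZ
      (by-signs (H ∷ X ∷ W ∷ Z ∷ []) (x₀ ≼ₜ x₁ ∷ x₃ ≼ₜ x₁ ∷ x₃ ∙ (x₀ ∙ x₂) ≈ x₃ ∙ ⊖ x₁ ∷ []) (x₀ ≼ₜ x₃)
        (_⋖_.below H⋖X) Z≼X p) Z≼X
  ... | inj₁ refl = inj₂ (inj₂ (by-signs (H ∷ X ∷ W ∷ []) (x₀ ∙ (x₀ ∙ x₂) ≈ x₀ ∙ ⊖ x₁ ∷ [])
                      (x₀ ∙ x₂ ≈ x₀ ∙ ⊖ x₁) p))
  ... | inj₂ Z≡X  = contradiction Z≡X Z≢X

  -- The first face met can have small rank. A coatom above it inherits the equation, which is only
  -- a condition at the zeros of the face, and makes the rank drop by just one.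
  facet-towards : ∀ {X Y} → Cov X → Cov Y → Y ⊑ X → ¬ Y ≼ X →
                  ∃ λ H → H ⋖ X × H ∘ᵥ Y ≡ H ∘ᵥ negV X
  facet-towards {X} {Y} cX cY Y⊑X Y⋠X =
    let (Z , cZ , Z≼X , Z≢X , p) = first-face _ ℕₚ.≤-refl cX cY Y⊑X Y⋠X
        (H , H⋖X , Z≼H)          = coatom-above _ ℕₚ.≤-refl cZ Z≼X Z≢X
    in H , H⋖X ,
       by-signs (X ∷ Y ∷ Z ∷ H ∷ []) (x₂ ≼ₜ x₃ ∷ x₃ ≼ₜ x₀ ∷ x₂ ∙ x₁ ≈ x₂ ∙ ⊖ x₀ ∷ [])
         (x₃ ∙ x₁ ≈ x₃ ∙ ⊖ x₀) Z≼H (_⋖_.below H⋖X) p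

-- The rank function: fuel, supports and gradedness

==ᵥ-does : (X Y : SV n) → (X ==ᵥ Y) ≡ does (X ≟ Y)
==ᵥ-does []      []      = refl
==ᵥ-does (x ∷ X) (y ∷ Y) = cong₂ _∧_ (signs x y) (==ᵥ-does X Y)
  where
  signs : ∀ x y → eqS x y ≡ does (x ≟ₛ y)
  signs pos pos = refl
  signs pos neg = refl
  signs pos zer = refl
  signs neg pos = refl
  signs neg neg = refl
  signs neg zer = refl
  signs zer pos = refl
  signs zer neg = refl
  signs zer zer = refl

≤ᵥ-does : (X Y : SV n) → (X ≤ᵥ Y) ≡ does (X ≼? Y)
≤ᵥ-does []      []      = refl
≤ᵥ-does (x ∷ X) (y ∷ Y) = cong₂ _∧_ (signs x y) (≤ᵥ-does X Y)
  where
  signs : ∀ x y → (isZer x ∨ eqS x y) ≡ does (compS x y ≟ₛ y)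
  signs pos pos = refl
  signs pos neg = refl
  signs pos zer = refl
  signs neg pos = refl
  signs neg neg = refl
  signs neg zer = refl
  signs zer pos = refl
  signs zer neg = refl
  signs zer zer = refl

infix 4 _≺_ _≺?_
_≺_ : SV n → SV n → Set
X ≺ Y = X ≼ Y × X ≢ Y

_≺?_ : (X Y : SV n) → Dec (X ≺ Y)
X ≺? Y = X ≼? Y ×-dec ¬? (X ≟ Y)

<ᵥ-does : (X Y : SV n) → (X <ᵥ Y) ≡ does (X ≺? Y)
<ᵥ-does X Y = cong₂ (λ b c → b ∧ not c) (≤ᵥ-does X Y) (==ᵥ-does X Y)

∈⇒≤max : ∀ {m ms} → m ∈ ms → m ℕ.≤ foldr _⊔_ 0 ms
∈⇒≤max {ms = m ∷ ms} (here refl) = ℕₚ.m≤m⊔n m _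
∈⇒≤max {ms = m ∷ ms} (there p)   = ℕₚ.m≤n⇒m≤o⊔n m (∈⇒≤max p)

outside : {X Y : SV n} → ¬ X ⊑ Y → ∃ λ e → (lookup Y e ≡ zer) × (lookup X e ≢ zer)
outside {X = X} {Y} X⋢Y = let (e , p) = differ X⋢Y in
  e , signs _ _ (p ∘ trans (lookup-zipWith compS e Y X))
  where
  signs : ∀ x y → compS y x ≢ y → (y ≡ zer) × (x ≢ zer)
  signs x pos p = contradiction refl p
  signs x neg p = contradiction refl p
  signs x zer p = refl , p

outside-⊑ : {X Y : SV n} → X ⊑ Y → ∀ e → lookup X e ≢ zer → lookup Y e ≢ zer
outside-⊑ {X = X} {Y} X⊑Y e p q = p (signs _ _ q (pointwise compS X⊑Y e))
  where
  signs : ∀ x y → y ≡ zer → compS y x ≡ y → x ≡ zer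
  signs x zer _ r = r

module Rank {n : ℕ} (M : OrientedMatroid n) where
  open Covectors M

  T⇒strictly-below : ∀ {Y X} → T (L M Y ∧ (Y <ᵥ X)) → Cov Y × Y ≺ X
  T⇒strictly-below {Y} {X} t = let (l , p) = Equivalence.to 𝔹.T-∧ t in
    Equivalence.to 𝔹.T-≡ l , toWitness {a? = Y ≺? X}
      (subst T (trans (<ᵥ-does Y X) (sym (isYes≗does (Y ≺? X)))) p)

  strictly-below⇒T : ∀ {Y X} → Cov Y → Y ≺ X → T (L M Y ∧ (Y <ᵥ X))
  strictly-below⇒T {Y} {X} cY p = Equivalence.from 𝔹.T-∧
    (Equivalence.from 𝔹.T-≡ cY , subst T (trans (isYes≗does (Y ≺? X)) (sym (<ᵥ-does Y X)))
      (fromWitness {a? = Y ≺? X} p))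

  rankF-< : ∀ k {X Y} → Cov Y → Y ≺ X → rankF k (L M) Y < rankF (suc k) (L M) X
  rankF-< k {X} cY p = ∈⇒≤max (∈-map⁺ (λ Y → suc (rankF k (L M) Y))
    (∈-filter⁺ (λ Y → T? (L M Y ∧ (Y <ᵥ X))) (∈-allSV _) (strictly-below⇒T cY p)))

  rankF-attained : ∀ k X → rankF (suc k) (L M) X ≡ 0 ⊎
    ∃ λ Y → Cov Y × Y ≺ X × rankF (suc k) (L M) X ≡ suc (rankF k (L M) Y)
  rankF-attained k X
    with foldr-selective ℕₚ.⊔-sel 0 (List.map (λ Y → suc (rankF k (L M) Y))
           (filter (λ Y → T? (L M Y ∧ (Y <ᵥ X))) (allSV n)))
  ... | inj₁ p = inj₁ p
  ... | inj₂ m =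
    let (Y , Y∈ , p) = ∈-map⁻ _ m
        (cY , Y≺X)   = T⇒strictly-below (proj₂ (∈-filter⁻ (λ Y → T? (L M Y ∧ (Y <ᵥ X))) {xs = allSV n} Y∈))
    in inj₂ (Y , cY , Y≺X , p)

  -- Supports shrink strictly along a chain, so fuel beyond the size of `X` has no effect. This
  -- identifies the value that the recursion uses for a proper face, with one unit of fuel less,
  -- with the rank of that face.
  rankF-stable : ∀ k X → size X < k → rankF k (L M) X ≡ rankF (suc k) (L M) X
  rankF-stable (suc k) X size<k = ℕₚ.≤-antisym (up (rankF-attained k X)) (down (rankF-attained (suc k) X))
    where
    IH : ∀ Y → Y ≺ X → rankF k (L M) Y ≡ rankF (suc k) (L M) Y
    IH Y (Y≼X , Y≢X) = rankF-stable k Y (ℕₚ.<-≤-trans (size-< Y≼X Y≢X) (s≤s⁻¹ size<k))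

    up : _ → rankF (suc k) (L M) X ℕ.≤ rankF (suc (suc k)) (L M) X
    up (inj₁ p) = ℕₚ.≤-trans (ℕₚ.≤-reflexive p) z≤n
    up (inj₂ (Y , cY , Y≺X , p)) =
      ℕₚ.≤-trans (ℕₚ.≤-reflexive (trans p (cong suc (IH Y Y≺X)))) (rankF-< (suc k) cY Y≺X)

    down : _ → rankF (suc (suc k)) (L M) X ℕ.≤ rankF (suc k) (L M) X
    down (inj₁ p) = ℕₚ.≤-trans (ℕₚ.≤-reflexive p) z≤n
    down (inj₂ (Y , cY , Y≺X , p)) =
      ℕₚ.≤-trans (ℕₚ.≤-reflexive (trans p (cong suc (sym (IH Y Y≺X))))) (rankF-< k cY Y≺X)

  rankF-rank : ∀ {X Y} → Y ≺ X → rankF n (L M) Y ≡ rank M Y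
  rankF-rank (Y≼X , Y≢X) = rankF-stable n _ (ℕₚ.<-≤-trans (size-< Y≼X Y≢X) (count-≤ _))

  rank-< : ∀ {X Y} → Cov Y → Y ≺ X → rank M Y < rank M X
  rank-< cY Y≺X = subst (_< _) (rankF-rank Y≺X) (rankF-< n cY Y≺X)

  rank-attained : ∀ X → rank M X ≡ 0 ⊎ ∃ λ Y → Cov Y × Y ≺ X × rank M X ≡ suc (rank M Y)
  rank-attained X with rankF-attained n X
  ... | inj₁ p = inj₁ p
  ... | inj₂ (Y , cY , Y≺X , p) = inj₂ (Y , cY , Y≺X , trans p (cong suc (rankF-rank Y≺X)))

  rank-0 : rank M zeroV ≡ 0
  rank-0 with rank-attained zeroV
  ... | inj₁ p = p
  ... | inj₂ (Y , _ , (Y≼0 , Y≢0) , _) = contradiction (≼-antisym Y≼0 (0≼ Y)) Y≢0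

  rank≡0 : ∀ {X} → rank M X ≡ 0 → X ≡ zeroV
  rank≡0 {X} p with X ≟ zeroV
  ... | yes q = q
  ... | no ¬q = contradiction (subst (_ <_) p (rank-< (V0 M) (0≼ X , ¬q ∘ sym))) λ ()

  -- The covering relation between supports. Covectors with equal supports are to be identified, so
  -- equality is replaced by mutual `⊑`.
  record _⋖ˢ_ (H X : SV n) : Set where
    field
      cov     : Cov H
      below   : H ⊑ X
      proper  : ¬ X ⊑ H
      maximal : ∀ {U} → Cov U → H ⊑ U → U ⊑ X → U ⊑ H ⊎ X ⊑ U

  -- For a support between those of `H` and `X`, `facet-sides` leaves three cases: on `H` the
  -- support is that of `H`, and on either side it is that of `X`.
  ⋖⇒⋖ˢ : ∀ {H X} → Cov X → H ⋖ X → H ⋖ˢ X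
  ⋖⇒⋖ˢ {H} {X} cX H⋖X = record
    { cov = cov ; below = ≼⇒⊑ below ; proper = λ X⊑H → proper (≼-⊑-antisym below X⊑H)
    ; maximal = λ {U} cU H⊑U U⊑X → sides U H⊑U (facet-sides cX H⋖X cU U⊑X) }
    where
    open _⋖_ H⋖X
    sides : ∀ U → H ⊑ U → H ∘ᵥ U ≡ H ⊎ H ∘ᵥ U ≡ X ⊎ H ∘ᵥ U ≡ H ∘ᵥ negV X → U ⊑ H ⊎ X ⊑ U
    sides U H⊑U (inj₁ p)        = inj₁ p
    sides U H⊑U (inj₂ (inj₁ p)) = inj₂
      (by-signs (H ∷ X ∷ U ∷ []) (x₀ ⊑ₜ x₂ ∷ x₀ ∙ x₂ ≈ x₁ ∷ []) (x₁ ⊑ₜ x₂) H⊑U p)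
    sides U H⊑U (inj₂ (inj₂ p)) = inj₂
      (by-signs (H ∷ X ∷ U ∷ []) (x₀ ⊑ₜ x₂ ∷ x₀ ∙ x₂ ≈ x₀ ∙ ⊖ x₁ ∷ []) (x₁ ⊑ₜ x₂) H⊑U p)

  rank⇒⋖ : ∀ {H X} → Cov H → H ≺ X → rank M X ≡ suc (rank M H) → H ⋖ X
  rank⇒⋖ {H} {X} cH (H≼X , H≢X) p = record
    { cov = cH ; below = H≼X ; proper = H≢X ; maximal = λ {U} cU a b → between U cU a b (U ≟ H) (U ≟ X) }
    where
    between : ∀ U → Cov U → H ≼ U → U ≼ X → Dec (U ≡ H) → Dec (U ≡ X) → U ≡ H ⊎ U ≡ X
    between U cU a b (yes q) _       = inj₁ q
    between U cU a b _       (yes q) = inj₂ q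
    between U cU a b (no ¬q) (no ¬r) = contradiction
      (ℕₚ.<-≤-trans (s≤s (rank-< cH (a , ¬q ∘ sym))) (rank-< cU (b , ¬r)))
      (ℕₚ.<-irrefl (sym p))

  -- Supports of compositions are unions, so composing all covectors supported in both `A` and `B`
  -- yields the largest common support.
  common-support : ∀ {A B} → Cov A → Cov B →
    ∃ λ J → Cov J × J ⊑ A × J ⊑ B × (∀ {U} → Cov U → U ⊑ A → U ⊑ B → U ⊑ J)
  common-support {A} {B} cA cB = let (J , cJ , JA , JB , top) = go (allSV n) in
    J , cJ , JA , JB , λ {U} cU UA UB → top (∈-allSV U) cU UA UB
    where
    go : ∀ Us → ∃ λ J → Cov J × J ⊑ A × J ⊑ B × (∀ {U} → U ∈ Us → Cov U → U ⊑ A → U ⊑ B → U ⊑ J)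
    go [] = zeroV , V0 M , ≼⇒⊑ (0≼ A) , ≼⇒⊑ (0≼ B) , λ ()
    go (V ∷ Us) with J , cJ , JA , JB , top ← go Us | cov? V ×-dec V ⊑? A ×-dec V ⊑? B
    ... | no ¬p = J , cJ , JA , JB ,
      λ { (here refl) cU UA UB → contradiction (cU , UA , UB) ¬p ; (there m) → top m }
    ... | yes (cV , VA , VB) = V ∘ᵥ J , cov-∘ cV cJ , join VA JA , join VB JB , λ
      { (here refl) _ _ _ → by-signs (V ∷ J ∷ []) [] (x₀ ⊑ₜ x₀ ∙ x₁)
      ; {U} (there m) cU UA UB →
          by-signs (V ∷ J ∷ U ∷ []) (x₂ ⊑ₜ x₁ ∷ []) (x₂ ⊑ₜ x₀ ∙ x₁) (top m cU UA UB) }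
      where
      join : ∀ {A} → V ⊑ A → J ⊑ A → (V ∘ᵥ J) ⊑ A
      join {A} = by-signs (V ∷ J ∷ A ∷ []) (x₀ ⊑ₜ x₂ ∷ x₁ ⊑ₜ x₂ ∷ []) (x₀ ∙ x₁ ⊑ₜ x₂)

  -- If a support K strictly between J and A were not contained in B, then eliminating between A
  -- and ± K at an element where B vanishes would produce a common support larger than J.
  semimodular : ∀ {A B X J} → Cov X → A ⋖ˢ X → B ⋖ˢ X → ¬ A ⊑ B → Cov J → J ⊑ A → J ⊑ B →
                (∀ {U} → Cov U → U ⊑ A → U ⊑ B → U ⊑ J) → J ⋖ˢ A
  semimodular {A} {B} {X} {J} cX A⋖X B⋖X A⋢B cJ JA JB top = record
    { cov = cJ ; below = JA ; proper = λ AJ → A⋢B (⊑-trans AJ JB)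
    ; maximal = λ {K} cK JK KA → between K cK JK KA (A ⊑? K) (K ⊑? B) }
    where
    module A = _⋖ˢ_ A⋖X
    module B = _⋖ˢ_ B⋖X

    between : ∀ K → Cov K → J ⊑ K → K ⊑ A → Dec (A ⊑ K) → Dec (K ⊑ B) → K ⊑ J ⊎ A ⊑ K
    between K cK JK KA (yes p) _       = inj₂ p
    between K cK JK KA _       (yes q) = inj₁ (top cK KA q)
    between K cK JK KA (no ¬p) (no ¬q) = contradiction
      (by-signs (A ∷ V ∷ Z ∷ K ∷ []) (x₀ ⊓ x₁ ≼ₜ x₂ ∷ x₁ ⊑ₜ x₃ ∷ x₂ ⊑ₜ x₃ ∷ []) (x₀ ⊑ₜ x₃)
        low VK (⊑-trans (top cZ ZA ZB) JK)) ¬p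
      where
      e = proj₁ (outside ¬q)
      Be = proj₁ (proj₂ (outside ¬q))
      Ke = proj₂ (proj₂ (outside ¬q))
      Ae = outside-⊑ KA e Ke

      opposite : ∃ λ V → Cov V × V ⊑ K × sepS (lookup A e) (lookup V e) ≡ true
      opposite with sepS (lookup A e) (lookup K e) in p
      ... | true  = K , cK , by-signs (K ∷ []) [] (x₀ ⊑ₜ x₀) , p
      ... | false = negV K , cov-neg cK , by-signs (K ∷ []) [] (⊖ x₀ ⊑ₜ x₀) ,
        trans (cong (sepS (lookup A e)) (lookup-map e opp K)) (signs _ _ Ae Ke p)
        where
        signs : ∀ a k → a ≢ zer → k ≢ zer → sepS a k ≡ false → sepS a (opp k) ≡ true
        signs pos pos _ _ _ = refl
        signs neg neg _ _ _ = refl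
        signs zer _   p _ _ = contradiction refl p
        signs pos zer _ p _ = contradiction refl p
        signs neg zer _ p _ = contradiction refl p

      V   = proj₁ opposite
      cV  = proj₁ (proj₂ opposite)
      VK  = proj₁ (proj₂ (proj₂ opposite))
      sep = proj₂ (proj₂ (proj₂ opposite))
      elimination = eliminate (_⋖ˢ_.cov A⋖X) cV e sep
      Z   = proj₁ elimination
      cZ  = proj₁ (proj₂ elimination)
      Ze  = proj₁ (proj₂ (proj₂ elimination))
      low = proj₁ (proj₂ (proj₂ (proj₂ elimination)))
      up  = proj₂ (proj₂ (proj₂ (proj₂ elimination)))

      ZA : Z ⊑ A
      ZA = by-signs (A ∷ V ∷ Z ∷ []) (x₁ ⊑ₜ x₀ ∷ x₂ ⊑ₜ x₀ ∙ x₁ ∷ []) (x₂ ⊑ₜ x₀) (⊑-trans VK KA) up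

      -- `B` and `Z` both vanish at `e`, where `X` does not. So `B ∘ᵥ Z` falls short of the support
      -- of `X`, and as `B` is a coatom, composing with `Z` adds nothing to its support.
      ZB : Z ⊑ B
      ZB with B.maximal (cov-∘ B.cov cZ) (by-signs (B ∷ Z ∷ []) [] (x₀ ⊑ₜ x₀ ∙ x₁))
                (by-signs (B ∷ Z ∷ X ∷ []) (x₀ ⊑ₜ x₂ ∷ x₁ ⊑ₜ x₂ ∷ []) (x₀ ∙ x₁ ⊑ₜ x₂)
                  B.below (⊑-trans ZA A.below))
      ... | inj₁ p = by-signs (B ∷ Z ∷ []) (x₀ ∙ x₁ ⊑ₜ x₀ ∷ []) (x₁ ⊑ₜ x₀) p
      ... | inj₂ p = contradiction
        (trans (lookup-zipWith compS e B Z) (trans (cong (λ s → compS s (lookup Z e)) Be) Ze))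
        (outside-⊑ p e (outside-⊑ A.below e Ae))

  -- The length of some maximal chain of supports. As a relation it makes gradedness a uniqueness
  -- statement, and it sees only the support of its covector.
  data Grade : SV n → ℕ → Set where
    base : ∀ {X} → X ⊑ zeroV → Grade X 0
    step : ∀ {H X r} → Cov X → H ⋖ˢ X → Grade H r → Grade X (suc r)

  ⋖ˢ-resp : ∀ {H X Y} → X ⊑ Y → Y ⊑ X → H ⋖ˢ X → H ⋖ˢ Y
  ⋖ˢ-resp XY YX H⋖X = record
    { cov = cov ; below = ⊑-trans below XY ; proper = proper ∘ ⊑-trans XY
    ; maximal = λ cU HU UY → map₂ (⊑-trans YX) (maximal cU HU (⊑-trans UY YX)) }
    where open _⋖ˢ_ H⋖X

  Grade-resp : ∀ {X Y r} → Cov Y → X ⊑ Y → Y ⊑ X → Grade X r → Grade Y r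
  Grade-resp cY XY YX (base p)       = base (⊑-trans YX p)
  Grade-resp cY XY YX (step cX c g)  = step cY (⋖ˢ-resp XY YX c) g

  grade-rank : ∀ r X → Cov X → rank M X ≡ r → Grade X r
  grade-rank zero    X cX p = base (subst (_⊑ zeroV) (sym (rank≡0 p)) (≼⇒⊑ ≼-refl))
  grade-rank (suc r) X cX p with rank-attained X
  ... | inj₁ q = contradiction (trans (sym p) q) λ ()
  ... | inj₂ (Y , cY , Y≺X , q) = step cX (⋖⇒⋖ˢ cX (rank⇒⋖ cY Y≺X q))
    (grade-rank r Y cY (ℕₚ.suc-injective (trans (sym q) p)))

  -- The Jordan-Dedekind argument: two coatoms with different supports both cover their largest
  -- common support, by `semimodular`, and the two chains are compared through it.
  grade-unique : ∀ {r s X} → Grade X r → Grade X s → r ≡ s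
  grade-unique (base _) (base _) = refl
  grade-unique (base p) (step _ c _) = contradiction (⊑-trans p (≼⇒⊑ (0≼ _))) (_⋖ˢ_.proper c)
  grade-unique (step _ c _) (base p) = contradiction (⊑-trans p (≼⇒⊑ (0≼ _))) (_⋖ˢ_.proper c)
  grade-unique {suc r} {suc s} (step {A} cX A⋖X gA) (step {B} _ B⋖X gB) with A ⊑? B
  ... | yes AB = cong suc (grade-unique gA (Grade-resp A.cov BA AB gB))
    where
    module A = _⋖ˢ_ A⋖X
    module B = _⋖ˢ_ B⋖X
    BA : B ⊑ A
    BA with A.maximal B.cov AB B.below
    ... | inj₁ p = p
    ... | inj₂ p = contradiction p B.proper
  ... | no ¬AB =
    let (J , cJ , JA , JB , top) = common-support A.cov B.cov
        gJ  = grade-rank _ J cJ refl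
        J⋖A = semimodular cX A⋖X B⋖X ¬AB cJ JA JB top
        J⋖B = semimodular cX B⋖X A⋖X ¬BA cJ JB JA λ cU UB UA → top cU UA UB
        r≡  = grade-unique gA (step A.cov J⋖A gJ)
    -- The chain through `J` is not a part of the given one; transported to index `r`, it makes this
    -- call smaller in the first index.
    in cong suc (grade-unique (subst (Grade B) (sym r≡) (step B.cov J⋖B gJ)) gB)
    where
    module A = _⋖ˢ_ A⋖X
    module B = _⋖ˢ_ B⋖X
    ¬BA : ¬ B ⊑ A
    ¬BA BA with B.maximal A.cov BA A.below
    ... | inj₁ p = ¬AB p
    ... | inj₂ p = A.proper p

  rank-support : ∀ {X Y} → Cov X → Cov Y → X ⊑ Y → Y ⊑ X → rank M X ≡ rank M Y
  rank-support cX cY XY YX = grade-unique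
    (Grade-resp cY XY YX (grade-rank _ _ cX refl)) (grade-rank _ _ cY refl)

  rank-⋖ : ∀ {H X} → Cov X → H ⋖ X → rank M X ≡ suc (rank M H)
  rank-⋖ cX H⋖X = grade-unique (grade-rank _ _ cX refl)
    (step cX (⋖⇒⋖ˢ cX H⋖X) (grade-rank _ _ (_⋖_.cov H⋖X) refl))

-- Sums over all sign vectors, and indicators

∑ : (SV n → ℤ) → ℤ
∑ {zero}  f = f []
∑ {suc n} f = ∑ (f ∘ (pos ∷_)) + (∑ (f ∘ (neg ∷_)) + ∑ (f ∘ (zer ∷_)))

∑-cong : {f g : SV n → ℤ} → (∀ X → f X ≡ g X) → ∑ f ≡ ∑ g
∑-cong {zero}  p = p []
∑-cong {suc n} p =
  cong₂ _+_ (∑-cong (p ∘ (pos ∷_))) (cong₂ _+_ (∑-cong (p ∘ (neg ∷_))) (∑-cong (p ∘ (zer ∷_))))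

∑-+ : (f g : SV n → ℤ) → ∑ (λ X → f X + g X) ≡ ∑ f + ∑ g
∑-+ {zero}  f g = refl
∑-+ {suc n} f g = trans
  (cong₂ _+_ (∑-+ (f ∘ (pos ∷_)) (g ∘ (pos ∷_)))
    (cong₂ _+_ (∑-+ (f ∘ (neg ∷_)) (g ∘ (neg ∷_))) (∑-+ (f ∘ (zer ∷_)) (g ∘ (zer ∷_)))))
  (shuffle (∑ (f ∘ (pos ∷_))) (∑ (g ∘ (pos ∷_))) (∑ (f ∘ (neg ∷_))) (∑ (g ∘ (neg ∷_)))
    (∑ (f ∘ (zer ∷_))) (∑ (g ∘ (zer ∷_))))
  where
  shuffle : ∀ a b c d e f → (a + b) + ((c + d) + (e + f)) ≡ (a + (c + e)) + (b + (d + f))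
  shuffle = solve-∀

∑-+₃ : (f g h : SV n → ℤ) → ∑ (λ X → f X + (g X + h X)) ≡ ∑ f + (∑ g + ∑ h)
∑-+₃ f g h = trans (∑-+ f (λ X → g X + h X)) (cong (∑ f +_) (∑-+ g h))

∑-*ˡ : (c : ℤ) (f : SV n → ℤ) → ∑ (λ X → c * f X) ≡ c * ∑ f
∑-*ˡ {zero}  c f = refl
∑-*ˡ {suc n} c f = trans
  (cong₂ _+_ (∑-*ˡ c (f ∘ (pos ∷_))) (cong₂ _+_ (∑-*ˡ c (f ∘ (neg ∷_))) (∑-*ˡ c (f ∘ (zer ∷_)))))
  (distrib c (∑ (f ∘ (pos ∷_))) (∑ (f ∘ (neg ∷_))) (∑ (f ∘ (zer ∷_))))
  where
  distrib : ∀ c x y z → c * x + (c * y + c * z) ≡ c * (x + (y + z))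
  distrib = solve-∀

∑-*ʳ : (c : ℤ) (f : SV n → ℤ) → ∑ (λ X → f X * c) ≡ ∑ f * c
∑-*ʳ c f = trans (∑-cong λ X → ℤₚ.*-comm (f X) c) (trans (∑-*ˡ c f) (ℤₚ.*-comm c (∑ f)))

∑-0 : {f : SV n → ℤ} → (∀ X → f X ≡ 0ℤ) → ∑ f ≡ 0ℤ
∑-0 {zero}  p = p []
∑-0 {suc n} p =
  cong₂ _+_ (∑-0 (p ∘ (pos ∷_))) (cong₂ _+_ (∑-0 (p ∘ (neg ∷_))) (∑-0 (p ∘ (zer ∷_))))

∑-swap : ∀ {m} (f : SV m → SV n → ℤ) → ∑ (λ X → ∑ (f X)) ≡ ∑ (λ Y → ∑ (λ X → f X Y))
∑-swap {m = zero}  f = refl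
∑-swap {m = suc m} f = trans
  (cong₂ _+_ (∑-swap (f ∘ (pos ∷_))) (cong₂ _+_ (∑-swap (f ∘ (neg ∷_))) (∑-swap (f ∘ (zer ∷_)))))
  (sym (∑-+₃ (λ Y → ∑ (λ X → f (pos ∷ X) Y)) (λ Y → ∑ (λ X → f (neg ∷ X) Y))
    (λ Y → ∑ (λ X → f (zer ∷ X) Y))))

∑-neg : (f : SV n → ℤ) → ∑ (f ∘ negV) ≡ ∑ f
∑-neg {zero}  f = refl
∑-neg {suc n} f = trans
  (cong₂ _+_ (∑-neg (f ∘ (neg ∷_))) (cong₂ _+_ (∑-neg (f ∘ (pos ∷_))) (∑-neg (f ∘ (zer ∷_)))))
  (exchange (∑ (f ∘ (neg ∷_))) (∑ (f ∘ (pos ∷_))) (∑ (f ∘ (zer ∷_))))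
  where
  exchange : ∀ x y z → x + (y + z) ≡ y + (x + z)
  exchange = solve-∀

∑-mono : {f g : SV n → ℤ} → (∀ X → f X ≤ g X) → ∑ f ≤ ∑ g
∑-mono {zero}  p = p []
∑-mono {suc n} p = ℤₚ.+-mono-≤ (∑-mono (p ∘ (pos ∷_)))
  (ℤₚ.+-mono-≤ (∑-mono (p ∘ (neg ∷_))) (∑-mono (p ∘ (zer ∷_))))

∑-allSV : (f : SV n → ℤ) → foldr (λ X s → f X + s) 0ℤ (allSV n) ≡ ∑ f
∑-allSV {zero}  f = ℤₚ.+-identityʳ (f [])
∑-allSV {suc n} f = trans (expand (allSV n)) (trans
  (∑-allSV λ X → f (pos ∷ X) + (f (neg ∷ X) + f (zer ∷ X)))
  (∑-+₃ (f ∘ (pos ∷_)) (f ∘ (neg ∷_)) (f ∘ (zer ∷_))))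
  where
  regroup : ∀ a b c s → a + (b + (c + s)) ≡ (a + (b + c)) + s
  regroup = solve-∀

  expand : ∀ Xs → foldr (λ X s → f X + s) 0ℤ
      (concatMap (λ v → (pos ∷ v) ∷ (neg ∷ v) ∷ (zer ∷ v) ∷ []) Xs) ≡
    foldr (λ X s → (f (pos ∷ X) + (f (neg ∷ X) + f (zer ∷ X))) + s) 0ℤ Xs
  expand []       = refl
  expand (X ∷ Xs) = trans
    (cong (λ s → f (pos ∷ X) + (f (neg ∷ X) + (f (zer ∷ X) + s))) (expand Xs))
    (regroup (f (pos ∷ X)) (f (neg ∷ X)) (f (zer ∷ X)) _)

private variable P Q : Set

𝟙 : Dec P → ℤ
𝟙 d = if does d then 1ℤ else 0ℤ

𝟙-yes : (d : Dec P) → P → 𝟙 d ≡ 1ℤ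
𝟙-yes (yes _) p = refl
𝟙-yes (no ¬p) p = contradiction p ¬p

𝟙-no : (d : Dec P) → ¬ P → 𝟙 d ≡ 0ℤ
𝟙-no (yes p) ¬p = contradiction p ¬p
𝟙-no (no _)  ¬p = refl

𝟙-cong : (d : Dec P) (e : Dec Q) → (P → Q) → (Q → P) → 𝟙 d ≡ 𝟙 e
𝟙-cong (yes p) e f g = sym (𝟙-yes e (f p))
𝟙-cong (no ¬p) e f g = sym (𝟙-no e (¬p ∘ g))

𝟙-× : (d : Dec P) (e : Dec Q) → 𝟙 (d ×-dec e) ≡ 𝟙 d * 𝟙 e
𝟙-× (yes _) (yes _) = refl
𝟙-× (yes _) (no _)  = refl
𝟙-× (no _)  (yes _) = refl
𝟙-× (no _)  (no _)  = refl

𝟙-guard : (d : Dec P) {x y : ℤ} → (P → x ≡ y) → 𝟙 d * x ≡ 𝟙 d * y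
𝟙-guard (yes p) f = cong (1ℤ *_) (f p)
𝟙-guard (no _)  f = refl

∑-δ : (Y : SV n) (f : SV n → ℤ) → ∑ (λ X → 𝟙 (X ≟ Y) * f X) ≡ f Y
∑-δ []      f = ℤₚ.*-identityˡ (f [])
∑-δ (y ∷ Y) f = signs y
  where
  same : ∀ y → ∑ (λ X → 𝟙 ((y ∷ X) ≟ (y ∷ Y)) * f (y ∷ X)) ≡ f (y ∷ Y)
  same y = trans (∑-cong λ X → cong (_* f (y ∷ X))
      (𝟙-cong ((y ∷ X) ≟ (y ∷ Y)) (X ≟ Y) ∷-injectiveʳ (cong (y ∷_))))
    (∑-δ Y (f ∘ (y ∷_)))

  other : ∀ x y → x ≢ y → ∑ (λ X → 𝟙 ((x ∷ X) ≟ (y ∷ Y)) * f (x ∷ X)) ≡ 0ℤ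
  other x y x≢y = ∑-0 λ X →
    cong (_* f (x ∷ X)) (𝟙-no ((x ∷ X) ≟ (y ∷ Y)) (x≢y ∘ ∷-injectiveˡ))

  signs : ∀ y → ∑ (λ X → 𝟙 (X ≟ (y ∷ Y)) * f X) ≡ f (y ∷ Y)
  signs pos = trans (cong₂ _+_ (same pos) (cong₂ _+_ (other neg pos λ ()) (other zer pos λ ())))
    (ℤₚ.+-identityʳ (f (pos ∷ Y)))
  signs neg = trans (cong₂ _+_ (other pos neg λ ()) (cong₂ _+_ (same neg) (other zer neg λ ())))
    (trans (ℤₚ.+-identityˡ (f (neg ∷ Y) + 0ℤ)) (ℤₚ.+-identityʳ (f (neg ∷ Y))))
  signs zer = trans (cong₂ _+_ (other pos zer λ ()) (cong₂ _+_ (other neg zer λ ()) (same zer)))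
    (trans (ℤₚ.+-identityˡ (0ℤ + f (zer ∷ Y))) (ℤₚ.+-identityˡ (f (zer ∷ Y))))

-- The signed sum of all faces, multiplied by a covector

separation-reflect : {H X Y : SV n} → H ≺ X → H ∘ᵥ Y ≡ H ∘ᵥ negV X → separation (H ∘ᵥ Y) Y < separation X Y
separation-reflect {H = H} {X} {Y} (H≼X , H≢X) p = let (e , q) = differ H≢X in
  count-mono-< (λ f → mono (lookup H f) (lookup X f) (lookup Y f) (pointwise compS H≼X f)
      ∘ trans (cong (λ s → sepS s (lookup Y f)) (sym (lookup-zipWith compS f H Y))))
    e (trans (cong (λ s → sepS s (lookup Y e)) (lookup-zipWith compS e H Y))
      (before _ _ _ (pointwise compS H≼X e) q))
    (after _ _ _ (pointwise compS H≼X e) (reflected e) q)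
  where
  reflected : ∀ e → compS (lookup H e) (lookup Y e) ≡ compS (lookup H e) (opp (lookup X e))
  reflected e = trans (pointwise compS p e) (trans (lookup-zipWith compS e H (negV X))
    (cong (compS (lookup H e)) (lookup-map e opp X)))

  mono : ∀ h x y → compS h x ≡ x → sepS (compS h y) y ≡ true → sepS x y ≡ true
  mono pos pos y _ q = q
  mono neg neg y _ q = q
  mono zer x pos _ ()
  mono zer x neg _ ()
  mono zer x zer _ ()

  before : ∀ h x y → compS h x ≡ x → h ≢ x → sepS (compS h y) y ≡ false
  before pos x y   r q = contradiction r q
  before neg x y   r q = contradiction r q
  before zer x pos r q = refl
  before zer x neg r q = refl
  before zer x zer r q = refl

  after : ∀ h x y → compS h x ≡ x → compS h y ≡ compS h (opp x) → h ≢ x → sepS x y ≡ true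
  after pos x   y   r s q = contradiction r q
  after neg x   y   r s q = contradiction r q
  after zer pos neg r s q = refl
  after zer neg pos r s q = refl
  after zer zer y   r s q = contradiction refl q

signed : ℕ → ℤ
signed zero    = 1ℤ
signed (suc r) = ℤ.- signed r

module FaceSums {n : ℕ} (M : OrientedMatroid n) where
  open Covectors M
  open Rank M

  sgn : SV n → ℤ
  sgn F = 𝟙 (cov? F) * signed (rank M F)

  sgn-cov : ∀ {F} → Cov F → sgn F ≡ signed (rank M F)
  sgn-cov {F} cF = trans (cong (_* signed (rank M F)) (𝟙-yes (cov? F) cF))
    (ℤₚ.*-identityˡ (signed (rank M F)))

  sgn-guard : ∀ F {x y} → (Cov F → x ≡ y) → sgn F * x ≡ sgn F * y
  sgn-guard F {x} {y} f = trans (ℤₚ.*-assoc (𝟙 (cov? F)) (signed (rank M F)) x)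
    (trans (𝟙-guard (cov? F) (cong (signed (rank M F) *_) ∘ f))
      (sym (ℤₚ.*-assoc (𝟙 (cov? F)) (signed (rank M F)) y)))

  sgn-noncov : ∀ {F} → ¬ Cov F → sgn F ≡ 0ℤ
  sgn-noncov {F} ¬cF = cong (_* signed (rank M F)) (𝟙-no (cov? F) ¬cF)

  -- Crossing from X to X′ = H ∘ − G through the facet H, the faces F with F ∘ X = G that are lost
  -- are those whose support lies in H, and these are counted in the restriction of G to H.
  crossing : ∀ {G X H F} → Cov X → X ⊑ G → G ⊑ X → H ⋖ X → H ∘ᵥ negV G ≡ H ∘ᵥ negV X → Cov F →
             𝟙 ((F ∘ᵥ X) ≟ G) ≡ 𝟙 ((F ∘ᵥ (H ∘ᵥ negV G)) ≟ G) + 𝟙 ((F ∘ᵥ H) ≟ (G ∣ᵥ H))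
  crossing {G} {X} {H} {F} cX XG GX H⋖X p cF with (F ∘ᵥ (H ∘ᵥ negV G)) ≟ G
  ... | yes q = trans
    (𝟙-yes ((F ∘ᵥ X) ≟ G)
      (by-signs (H ∷ X ∷ G ∷ F ∷ [])
        (x₀ ≼ₜ x₁ ∷ x₀ ∙ ⊖ x₂ ≈ x₀ ∙ ⊖ x₁ ∷ x₁ ⊑ₜ x₂ ∷ x₂ ⊑ₜ x₁ ∷ x₃ ∙ (x₀ ∙ ⊖ x₂) ≈ x₂ ∷ [])
        (x₃ ∙ x₁ ≈ x₂) below p XG GX q))
    (cong (1ℤ +_) (sym (𝟙-no ((F ∘ᵥ H) ≟ (G ∣ᵥ H)) λ r → proper
      (by-signs (H ∷ X ∷ G ∷ F ∷ [])
        (x₀ ≼ₜ x₁ ∷ x₀ ∙ ⊖ x₂ ≈ x₀ ∙ ⊖ x₁ ∷ x₁ ⊑ₜ x₂ ∷ x₂ ⊑ₜ x₁ ∷ x₃ ∙ (x₀ ∙ ⊖ x₂) ≈ x₂ ∷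
          x₃ ∙ x₀ ≈ x₂ ∣ x₀ ∷ [])
        (x₀ ≈ x₁) below p XG GX q r))))
    where open _⋖_ H⋖X
  ... | no ¬q = trans
    (𝟙-cong ((F ∘ᵥ X) ≟ G) ((F ∘ᵥ H) ≟ (G ∣ᵥ H)) lost
      (by-signs (H ∷ X ∷ G ∷ F ∷ [])
        (x₀ ≼ₜ x₁ ∷ x₀ ∙ ⊖ x₂ ≈ x₀ ∙ ⊖ x₁ ∷ x₁ ⊑ₜ x₂ ∷ x₂ ⊑ₜ x₁ ∷ x₃ ∙ x₀ ≈ x₂ ∣ x₀ ∷ [])
        (x₃ ∙ x₁ ≈ x₂) below p XG GX))
    (sym (ℤₚ.+-identityˡ (𝟙 ((F ∘ᵥ H) ≟ (G ∣ᵥ H)))))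
    where
    open _⋖_ H⋖X
    lost : F ∘ᵥ X ≡ G → F ∘ᵥ H ≡ G ∣ᵥ H
    -- Off the support of `H`, such an `F` has either no sign at all or already all signs of `G`. In
    -- the second case reversing the right factor there has no effect, so the product would still be
    -- `G`, against `¬q`.
    lost r with facet-sides cX H⋖X cF
      (by-signs (F ∷ X ∷ G ∷ []) (x₀ ∙ x₁ ≈ x₂ ∷ x₂ ⊑ₜ x₁ ∷ []) (x₀ ⊑ₜ x₁) r GX)
    ... | inj₁ s = by-signs (H ∷ X ∷ G ∷ F ∷ [])
      (x₀ ≼ₜ x₁ ∷ x₃ ∙ x₁ ≈ x₂ ∷ x₃ ⊑ₜ x₀ ∷ []) (x₃ ∙ x₀ ≈ x₂ ∣ x₀) below r s
    ... | inj₂ (inj₁ s) = contradiction (by-signs (H ∷ X ∷ G ∷ F ∷ [])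
      (x₀ ≼ₜ x₁ ∷ x₁ ⊑ₜ x₂ ∷ x₂ ⊑ₜ x₁ ∷ x₃ ∙ x₁ ≈ x₂ ∷ x₀ ∙ x₃ ≈ x₁ ∷ [])
      (x₃ ∙ (x₀ ∙ ⊖ x₂) ≈ x₂) below XG GX r s) ¬q
    ... | inj₂ (inj₂ s) = contradiction (by-signs (H ∷ X ∷ G ∷ F ∷ [])
      (x₀ ≼ₜ x₁ ∷ x₁ ⊑ₜ x₂ ∷ x₂ ⊑ₜ x₁ ∷ x₃ ∙ x₁ ≈ x₂ ∷ x₀ ∙ x₃ ≈ x₀ ∙ ⊖ x₁ ∷ [])
      (x₃ ∙ (x₀ ∙ ⊖ x₂) ≈ x₂) below XG GX r s) ¬q

  FaceSum : SV n → SV n → ℤ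
  FaceSum X G = ∑ λ F → sgn F * 𝟙 ((F ∘ᵥ X) ≟ G)

  -- A zero of `F` in the support of `G` would give the product the wrong sign there, so only
  -- `F = G` contributes. This is where the movement of `X` ends.
  face-sum-opposite : ∀ G → FaceSum (negV G) G ≡ sgn G
  face-sum-opposite G = trans
    (∑-cong λ F → trans (cong (sgn F *_)
      (𝟙-cong ((F ∘ᵥ negV G) ≟ G) (F ≟ G) (by-signs (F ∷ G ∷ []) (x₀ ∙ ⊖ x₁ ≈ x₁ ∷ []) (x₀ ≈ x₁))
        (λ { refl → by-signs (G ∷ []) [] (x₀ ∙ ⊖ x₀ ≈ x₀) })))
      (ℤₚ.*-comm (sgn F) (𝟙 (F ≟ G))))
    (∑-δ G sgn)

  face-sum-noncov : ∀ {X G} → Cov X → ¬ Cov G → FaceSum X G ≡ 0ℤ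
  face-sum-noncov {X} {G} cX ¬cG = ∑-0 λ F → trans
    (sgn-guard F λ cF → 𝟙-no ((F ∘ᵥ X) ≟ G) λ p → ¬cG (subst Cov p (cov-∘ cF cX)))
    (ℤₚ.*-zeroʳ (sgn F))

  face-sum-crossing : ∀ {G X H} → Cov X → X ⊑ G → G ⊑ X → H ⋖ X → H ∘ᵥ negV G ≡ H ∘ᵥ negV X →
                      FaceSum X G ≡ FaceSum (H ∘ᵥ negV G) G + FaceSum H (G ∣ᵥ H)
  face-sum-crossing {G} {X} {H} cX XG GX H⋖X p = trans
    (∑-cong λ F → trans (sgn-guard F (crossing cX XG GX H⋖X p))
      (ℤₚ.*-distribˡ-+ (sgn F) (𝟙 ((F ∘ᵥ (H ∘ᵥ negV G)) ≟ G)) (𝟙 ((F ∘ᵥ H) ≟ (G ∣ᵥ H)))))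
    (∑-+ (λ F → sgn F * 𝟙 ((F ∘ᵥ (H ∘ᵥ negV G)) ≟ G)) (λ F → sgn F * 𝟙 ((F ∘ᵥ H) ≟ (G ∣ᵥ H))))

  -- H = − E exactly when X′ = − G, and then the two contributions cancel because the ranks of E
  -- and G differ by one.
  face-sum-cancel : ∀ {G X H} → Cov X → Cov G → X ⊑ G → G ⊑ X → H ⋖ X → H ∘ᵥ negV G ≡ H ∘ᵥ negV X →
    sgn G * 𝟙 ((H ∘ᵥ negV G) ≟ negV G) + sgn (G ∣ᵥ H) * 𝟙 (H ≟ negV (G ∣ᵥ H)) ≡ 0ℤ
  face-sum-cancel {G} {X} {H} cX cG XG GX H⋖X p = cases ((H ∘ᵥ negV G) ≟ negV G)
    where
    open _⋖_ H⋖X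
    E = G ∣ᵥ H

    cases : (d : Dec (H ∘ᵥ negV G ≡ negV G)) → sgn G * 𝟙 d + sgn E * 𝟙 (H ≟ negV E) ≡ 0ℤ
    cases (no ¬q) = cong₂ _+_ (ℤₚ.*-zeroʳ (sgn G)) (trans
      (cong (sgn E *_) (𝟙-no (H ≟ negV E) λ r → ¬q
        (by-signs (H ∷ G ∷ []) (x₀ ≈ ⊖ (x₁ ∣ x₀) ∷ []) (x₀ ∙ ⊖ x₁ ≈ ⊖ x₁) r)))
      (ℤₚ.*-zeroʳ (sgn E)))
    cases (yes q) = trans
      (cong₂ _+_ (ℤₚ.*-identityʳ (sgn G)) (trans
        (cong (sgn E *_) (𝟙-yes (H ≟ negV E) H≡-E)) (ℤₚ.*-identityʳ (sgn E))))
      (trans (cong₂ _+_ (trans (sgn-cov cG) (cong signed rank-G)) (sgn-cov cE))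
        (ℤₚ.+-inverseˡ (signed (rank M E))))
      where
      H≡-E : H ≡ negV E
      H≡-E = by-signs (H ∷ G ∷ []) (x₀ ∙ ⊖ x₁ ≈ ⊖ x₁ ∷ []) (x₀ ≈ ⊖ (x₁ ∣ x₀)) q

      cE : Cov E
      cE = subst Cov (trans (cong negV H≡-E) (neg-involutive E)) (cov-neg cov)

      rank-G : rank M G ≡ suc (rank M E)
      rank-G = trans (rank-support cG cX GX XG) (trans (rank-⋖ cX H⋖X) (cong suc
        (rank-support cov cE
          (by-signs (H ∷ G ∷ []) (x₀ ≈ ⊖ (x₁ ∣ x₀) ∷ []) (x₀ ⊑ₜ x₁ ∣ x₀) H≡-E)
          (by-signs (H ∷ G ∷ []) [] (x₁ ∣ x₀ ⊑ₜ x₀)))))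

  SameSupportSum : SV n → SV n → Set
  SameSupportSum X G =
    Cov X → Cov G → X ⊑ G → G ⊑ X → FaceSum X G ≡ sgn G * 𝟙 (X ≟ negV G)

  same-support-step : ∀ {X G} →
    (∀ {X′} → separation X′ (negV G) < separation X (negV G) → SameSupportSum X′ G) →
    (∀ {H E} → size E < size G → SameSupportSum H E) → SameSupportSum X G
  same-support-step {X} {G} closer smaller cX cG XG GX = cases (X ≟ negV G)
    where
    cases : (d : Dec (X ≡ negV G)) → FaceSum X G ≡ sgn G * 𝟙 d
    cases (yes q) = trans (cong (λ X → FaceSum X G) q)
      (trans (face-sum-opposite G) (sym (ℤₚ.*-identityʳ (sgn G))))
    cases (no X≢-G) = across (facet-towards cX (cov-neg cG)
        (by-signs (G ∷ X ∷ []) (x₀ ⊑ₜ x₁ ∷ []) (⊖ x₀ ⊑ₜ x₁) GX)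
        (λ q → X≢-G (by-signs (G ∷ X ∷ []) (x₁ ⊑ₜ x₀ ∷ ⊖ x₀ ≼ₜ x₁ ∷ []) (x₁ ≈ ⊖ x₀) XG q)))
      where
      across : (∃ λ H → H ⋖ X × H ∘ᵥ negV G ≡ H ∘ᵥ negV X) → FaceSum X G ≡ sgn G * 0ℤ
      across (H , H⋖X , p) = trans (face-sum-crossing cX XG GX H⋖X p)
        (trans (cong₂ _+_ upper (lower (cov? E)))
          (trans (face-sum-cancel cX cG XG GX H⋖X p) (sym (ℤₚ.*-zeroʳ (sgn G)))))
        where
        open _⋖_ H⋖X
        E = G ∣ᵥ H

        upper : FaceSum (H ∘ᵥ negV G) G ≡ sgn G * 𝟙 ((H ∘ᵥ negV G) ≟ negV G)
        upper = closer (separation-reflect (below , proper) p) (cov-∘ cov (cov-neg cG)) cG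
          (by-signs (H ∷ X ∷ G ∷ []) (x₀ ≼ₜ x₁ ∷ x₁ ⊑ₜ x₂ ∷ []) (x₀ ∙ ⊖ x₂ ⊑ₜ x₂) below XG)
          (by-signs (H ∷ G ∷ []) [] (x₁ ⊑ₜ x₀ ∙ ⊖ x₁))

        lower : Dec (Cov E) → FaceSum H E ≡ sgn E * 𝟙 (H ≟ negV E)
        lower (no ¬cE) = trans (face-sum-noncov cov ¬cE)
          (sym (cong (_* 𝟙 (H ≟ negV E)) (sgn-noncov ¬cE)))
        lower (yes cE) = smaller (ℕₚ.≤-<-trans
            (size-≤ (by-signs (H ∷ G ∷ []) [] (x₁ ∣ x₀ ⊑ₜ x₀)))
            (ℕₚ.<-≤-trans (size-< below proper) (size-≤ XG)))
          cov cE
          (by-signs (H ∷ X ∷ G ∷ []) (x₀ ≼ₜ x₁ ∷ x₁ ⊑ₜ x₂ ∷ []) (x₀ ⊑ₜ x₂ ∣ x₀) below XG)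
          (by-signs (H ∷ G ∷ []) [] (x₁ ∣ x₀ ⊑ₜ x₀))

  -- Lexicographic induction. After a crossing, one term keeps `G` and is nearer to its negative;
  -- the other has a target with smaller support, so its separation bound may start afresh.
  same-support-sum : ∀ s d {G X} → size G < s → separation X (negV G) < d → SameSupportSum X G
  same-support-sum zero    d       ()
  same-support-sum (suc s) zero    _ ()
  same-support-sum (suc s) (suc d) <s <d = same-support-step
    (λ lt → same-support-sum (suc s) d <s (ℕₚ.<-≤-trans lt (s≤s⁻¹ <d)))
    (λ lt → same-support-sum s _ (ℕₚ.<-≤-trans lt (s≤s⁻¹ <s)) ℕₚ.≤-refl)

  -- Reduction to equal supports: `X` may be replaced by `X ∘ᵥ negV G` when it is supported in `G`,
  -- because at the zeros of `X` either product equals `G` only if `F` does.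
  face-sum : ∀ {X} → Cov X → ∀ G → FaceSum X G ≡ sgn G * 𝟙 (X ≼? negV G)
  face-sum {X} cX G = cases (cov? G) (X ⊑? G)
    where
    cases : Dec (Cov G) → Dec (X ⊑ G) → FaceSum X G ≡ sgn G * 𝟙 (X ≼? negV G)
    cases (no ¬cG) _ = trans (face-sum-noncov cX ¬cG)
      (sym (cong (_* 𝟙 (X ≼? negV G)) (sgn-noncov ¬cG)))
    cases (yes cG) (no X⋢G) = trans
      (∑-0 λ F → trans (cong (sgn F *_) (𝟙-no ((F ∘ᵥ X) ≟ G) λ p → X⋢G
        (by-signs (F ∷ X ∷ G ∷ []) (x₀ ∙ x₁ ≈ x₂ ∷ []) (x₁ ⊑ₜ x₂) p))) (ℤₚ.*-zeroʳ (sgn F)))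
      (sym (trans (cong (sgn G *_) (𝟙-no (X ≼? negV G) λ p → X⋢G
        (by-signs (X ∷ G ∷ []) (x₀ ≼ₜ ⊖ x₁ ∷ []) (x₀ ⊑ₜ x₁) p))) (ℤₚ.*-zeroʳ (sgn G))))
    cases (yes cG) (yes XG) = trans
      (∑-cong λ F → cong (sgn F *_) (𝟙-cong ((F ∘ᵥ X) ≟ G) ((F ∘ᵥ (X ∘ᵥ negV G)) ≟ G)
        (by-signs (F ∷ X ∷ G ∷ []) (x₀ ∙ x₁ ≈ x₂ ∷ []) (x₀ ∙ (x₁ ∙ ⊖ x₂) ≈ x₂))
        (by-signs (F ∷ X ∷ G ∷ []) (x₁ ⊑ₜ x₂ ∷ x₀ ∙ (x₁ ∙ ⊖ x₂) ≈ x₂ ∷ []) (x₀ ∙ x₁ ≈ x₂) XG)))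
      (trans (same-support-sum _ _ ℕₚ.≤-refl ℕₚ.≤-refl (cov-∘ cX (cov-neg cG)) cG
        (by-signs (X ∷ G ∷ []) (x₀ ⊑ₜ x₁ ∷ []) (x₀ ∙ ⊖ x₁ ⊑ₜ x₁) XG)
        (by-signs (X ∷ G ∷ []) [] (x₁ ⊑ₜ x₀ ∙ ⊖ x₁)))
      (cong (sgn G *_) (𝟙-cong ((X ∘ᵥ negV G) ≟ negV G) (X ≼? negV G) id id)))

-- Weighted sums and the Euler relations

*-exchange : ∀ a b c → a * (b * c) ≡ b * (a * c)
*-exchange = solve-∀

Weighted : (SV n → ℤ) → (SV n → ℤ) → ℤ
Weighted w φ = ∑ λ X → w X * φ X

Weighted-swap : (w v : SV n → ℤ) (φ : SV n → SV n → ℤ) →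
  Weighted w (λ X → Weighted v (φ X)) ≡ Weighted v (λ Y → Weighted w (λ X → φ X Y))
Weighted-swap w v φ = trans (∑-cong λ X → sym (∑-*ˡ (w X) (λ Y → v Y * φ X Y)))
  (trans (∑-swap λ X Y → w X * (v Y * φ X Y))
    (∑-cong λ Y → trans (∑-cong λ X → *-exchange (w X) (v Y) (φ X Y)) (∑-*ˡ (v Y) (λ X → w X * φ X Y))))

Weighted-+ : (w φ ψ : SV n → ℤ) → Weighted w (λ X → φ X + ψ X) ≡ Weighted w φ + Weighted w ψ
Weighted-+ w φ ψ = trans (∑-cong λ X → ℤₚ.*-distribˡ-+ (w X) (φ X) (ψ X))
  (∑-+ (λ X → w X * φ X) (λ X → w X * ψ X))

Weighted-*ˡ : (c : ℤ) (w φ : SV n → ℤ) → Weighted w (λ X → c * φ X) ≡ c * Weighted w φ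
Weighted-*ˡ c w φ = trans (∑-cong λ X → *-exchange (w X) c (φ X)) (∑-*ˡ c (λ X → w X * φ X))

Weighted-*ʳ : (c : ℤ) (w φ : SV n → ℤ) → Weighted w (λ X → φ X * c) ≡ Weighted w φ * c
Weighted-*ʳ c w φ = trans (∑-cong λ X → sym (ℤₚ.*-assoc (w X) (φ X) c)) (∑-*ʳ c (λ X → w X * φ X))

Weighted-δ : (w φ : SV n → ℤ) (Y : SV n) → Weighted w (λ X → 𝟙 (X ≟ Y) * φ X) ≡ w Y * φ Y
Weighted-δ w φ Y = trans (∑-cong λ X → *-exchange (w X) (𝟙 (X ≟ Y)) (φ X)) (∑-δ Y (λ X → w X * φ X))

Weighted-δ₁ : (w : SV n → ℤ) (Y : SV n) → Weighted w (λ X → 𝟙 (X ≟ Y)) ≡ w Y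
Weighted-δ₁ w Y = trans (∑-cong λ X → ℤₚ.*-comm (w X) (𝟙 (X ≟ Y))) (∑-δ Y w)

module EulerRelations {n : ℕ} (M : OrientedMatroid n) where
  open Covectors M
  open Rank M
  open FaceSums M

  sgn-neg : ∀ G → sgn (negV G) ≡ sgn G
  sgn-neg G = trans
    (𝟙-guard (cov? (negV G)) λ c → cong signed (rank-support c (subst Cov (neg-involutive G) (cov-neg c))
      (by-signs (G ∷ []) [] (⊖ x₀ ⊑ₜ x₀)) (by-signs (G ∷ []) [] (x₀ ⊑ₜ ⊖ x₀))))
    (cong (_* signed (rank M G)) (𝟙-cong (cov? (negV G)) (cov? G)
      (λ c → subst Cov (neg-involutive G) (cov-neg c)) cov-neg))

  -- This applies the linear functional with values `φ` to the face identity, after collecting the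
  -- `F` with the same product. Suitable `φ` and `X` give the relations for supports and for upper
  -- sets.
  sum-over-targets : ∀ {X} → Cov X → (φ : SV n → ℤ) →
    Weighted sgn (λ F → φ (F ∘ᵥ X)) ≡ ∑ λ G → φ G * (sgn G * 𝟙 (X ≼? negV G))
  sum-over-targets {X} cX φ = trans
    (∑-cong λ F → cong (sgn F *_) (sym (trans
      (∑-cong λ G → trans (cong (φ G *_) (𝟙-cong ((F ∘ᵥ X) ≟ G) (G ≟ (F ∘ᵥ X)) sym sym))
        (ℤₚ.*-comm (φ G) (𝟙 (G ≟ (F ∘ᵥ X)))))
      (∑-δ (F ∘ᵥ X) φ))))
    (trans (Weighted-swap sgn φ (λ F G → 𝟙 ((F ∘ᵥ X) ≟ G)))
      (∑-cong λ G → cong (φ G *_) (face-sum cX G)))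

  -- Take `X = G` and for `φ` the indicator of being supported in `G`: the only surviving target is
  -- the negative of `G`.
  euler-support : ∀ {G} → Cov G → Weighted sgn (λ F → 𝟙 (F ⊑? G)) ≡ sgn G
  euler-support {G} cG = trans
    (∑-cong λ F → cong (sgn F *_) (𝟙-cong (F ⊑? G) ((F ∘ᵥ G) ⊑? G)
      (by-signs (F ∷ G ∷ []) (x₀ ⊑ₜ x₁ ∷ []) (x₀ ∙ x₁ ⊑ₜ x₁))
      (by-signs (F ∷ G ∷ []) (x₀ ∙ x₁ ⊑ₜ x₁ ∷ []) (x₀ ⊑ₜ x₁))))
    (trans (sum-over-targets cG (λ F → 𝟙 (F ⊑? G)))
    (trans (∑-cong λ F → trans (exchange (𝟙 (F ⊑? G)) (sgn F) (𝟙 (G ≼? negV F)))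
      (trans (cong (_* sgn F) (opposite F)) (ℤₚ.*-comm (𝟙 (F ≟ negV G)) (sgn F))))
    (trans (Weighted-δ₁ sgn (negV G)) (sgn-neg G))))
    where
    exchange : ∀ a b c → a * (b * c) ≡ (a * c) * b
    exchange = solve-∀

    opposite : ∀ F → 𝟙 (F ⊑? G) * 𝟙 (G ≼? negV F) ≡ 𝟙 (F ≟ negV G)
    opposite F = trans (sym (𝟙-× (F ⊑? G) (G ≼? negV F)))
      (𝟙-cong ((F ⊑? G) ×-dec (G ≼? negV F)) (F ≟ negV G)
        (λ (p , q) → by-signs (F ∷ G ∷ []) (x₀ ⊑ₜ x₁ ∷ x₁ ≼ₜ ⊖ x₀ ∷ []) (x₀ ≈ ⊖ x₁) p q)
        (λ p → by-signs (F ∷ G ∷ []) (x₀ ≈ ⊖ x₁ ∷ []) (x₀ ⊑ₜ x₁) p ,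
               by-signs (F ∷ G ∷ []) (x₀ ≈ ⊖ x₁ ∷ []) (x₁ ≼ₜ ⊖ x₀) p))

  -- Take `φ` constant and `X` the negative of `A`, so that the targets with nonzero coefficient are
  -- the covectors above `A`.
  euler-above : ∀ {A} → Cov A → Weighted sgn (λ G → 𝟙 (A ≼? G)) ≡ ∑ sgn
  euler-above {A} cA = trans
    (∑-cong λ G → trans
      (cong (sgn G *_) (𝟙-cong (A ≼? G) (negV A ≼? negV G)
        (by-signs (A ∷ G ∷ []) (x₀ ≼ₜ x₁ ∷ []) (⊖ x₀ ≼ₜ ⊖ x₁))
        (by-signs (A ∷ G ∷ []) (⊖ x₀ ≼ₜ ⊖ x₁ ∷ []) (x₀ ≼ₜ x₁))))
      (sym (ℤₚ.*-identityˡ (sgn G * 𝟙 (negV A ≼? negV G)))))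
    (trans (sym (sum-over-targets (cov-neg cA) (λ _ → 1ℤ)))
      (∑-cong λ F → ℤₚ.*-identityʳ (sgn F)))

  -- The right factor `negV A ∘ᵥ G` opposes `G` on the support of `A`, where `F` must therefore
  -- supply the sign, and equals `G` elsewhere, where `F` may be zero. So the interval is exactly
  -- the set of `F` with product `G`, and the face identity gives 0 there.
  euler-interval : ∀ {A G} → Cov A → Cov G → A ≼ G → A ≢ G →
                   Weighted sgn (λ F → 𝟙 ((A ≼? F) ×-dec (F ≼? G))) ≡ 0ℤ
  euler-interval {A} {G} cA cG A≼G A≢G = trans
    (∑-cong λ F → cong (sgn F *_) (𝟙-cong ((A ≼? F) ×-dec (F ≼? G)) ((F ∘ᵥ (negV A ∘ᵥ G)) ≟ G)
      (λ (p , q) → by-signs (A ∷ G ∷ F ∷ []) (x₀ ≼ₜ x₁ ∷ x₀ ≼ₜ x₂ ∷ x₂ ≼ₜ x₁ ∷ [])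
        (x₂ ∙ (⊖ x₀ ∙ x₁) ≈ x₁) A≼G p q)
      (λ p → by-signs (A ∷ G ∷ F ∷ []) (x₀ ≼ₜ x₁ ∷ x₂ ∙ (⊖ x₀ ∙ x₁) ≈ x₁ ∷ []) (x₀ ≼ₜ x₂) A≼G p ,
             by-signs (A ∷ G ∷ F ∷ []) (x₀ ≼ₜ x₁ ∷ x₂ ∙ (⊖ x₀ ∙ x₁) ≈ x₁ ∷ []) (x₂ ≼ₜ x₁) A≼G p)))
    (trans (face-sum (cov-∘ (cov-neg cA) cG) G)
      (trans (cong (sgn G *_) (𝟙-no ((negV A ∘ᵥ G) ≼? negV G) λ p → A≢G
        (by-signs (A ∷ G ∷ []) (x₀ ≼ₜ x₁ ∷ ⊖ x₀ ∙ x₁ ≼ₜ ⊖ x₁ ∷ []) (x₀ ≈ x₁) A≼G p)))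
      (ℤₚ.*-zeroʳ (sgn G))))

-- Rank three: face numbers and local incidences

module RankThree {n : ℕ} (M : OrientedMatroid n) (hasRank : HasRank M 3) where
  open Covectors M
  open Rank M
  open FaceSums M
  open EulerRelations M

  Face : ℕ → SV n → Set
  Face i X = Cov X × rank M X ≡ i

  face? : ∀ i X → Dec (Face i X)
  face? i X = cov? X ×-dec (rank M X ℕ.≟ i)

  r : ℕ → SV n → ℤ
  r i X = 𝟙 (face? i X)

  rank-≤3 : ∀ {X} → Cov X → rank M X ℕ.≤ 3
  rank-≤3 {X} = proj₂ hasRank X

  face-0 : Face 0 zeroV
  face-0 = V0 M , rank-0

  face-neg : ∀ {i X} → Face i X → Face i (negV X)
  face-neg {X = X} (cX , p) = cov-neg cX , trans (rank-support (cov-neg cX) cX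
    (by-signs (X ∷ []) [] (⊖ x₀ ⊑ₜ x₀)) (by-signs (X ∷ []) [] (x₀ ⊑ₜ ⊖ x₀))) p

  face-rank-≤ : ∀ {i j X Y} → Face i X → Face j Y → X ≼ Y → i ℕ.≤ j
  face-rank-≤ {X = X} {Y} (cX , refl) (cY , refl) X≼Y with X ≟ Y
  ... | yes refl = ℕₚ.≤-refl
  ... | no X≢Y   = ℕₚ.<⇒≤ (rank-< cX (X≼Y , X≢Y))

  same-rank : ∀ {i X Y} → Face i X → Face i Y → X ≼ Y → X ≡ Y
  same-rank {X = X} {Y} (cX , p) (cY , q) X≼Y with X ≟ Y
  ... | yes X≡Y = X≡Y
  ... | no X≢Y  = contradiction (rank-< cX (X≼Y , X≢Y)) (ℕₚ.<-irrefl (trans p (sym q)))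

  face-⋖ : ∀ {i H X} → Face i H → Face (suc i) X → H ≼ X → H ⋖ X
  face-⋖ (cH , p) (cX , q) H≼X = rank⇒⋖ cH
    (H≼X , λ { refl → ℕₚ.<-irrefl (trans (sym p) q) ℕₚ.≤-refl }) (trans q (cong suc (sym p)))

  facet-exists : ∀ {i X} → Face (suc i) X → ∃ λ H → Face i H × H ≼ X
  facet-exists {X = X} (cX , p) with rank-attained X
  ... | inj₁ q = contradiction (trans (sym p) q) λ ()
  ... | inj₂ (H , cH , (H≼X , _) , q) = H , (cH , ℕₚ.suc-injective (trans (sym q) p)) , H≼X

  tope-maximal : ∀ {T Y} → Face 3 T → Cov Y → T ≼ Y → T ≡ Y
  tope-maximal {T} {Y} fT cY T≼Y =
    same-rank fT (cY , ℕₚ.≤-antisym (rank-≤3 cY) (face-rank-≤ fT (cY , refl) T≼Y)) T≼Y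

  tope-⊒ : ∀ {T Y} → Face 3 T → Cov Y → Y ⊑ T
  tope-⊒ {T} {Y} fT cY = sym (tope-maximal fT (cov-∘ (proj₁ fT) cY) (x≼x∘y T Y))

  tope-∘ : ∀ {T Y} → Cov Y → Face 3 T → Face 3 (Y ∘ᵥ T)
  tope-∘ {T} {Y} cY fT = cov-∘ cY (proj₁ fT) , trans (rank-support (cov-∘ cY (proj₁ fT)) (proj₁ fT)
    (tope-⊒ fT (cov-∘ cY (proj₁ fT))) (by-signs (Y ∷ T ∷ []) [] (x₁ ⊑ₜ x₀ ∙ x₁))) (proj₂ fT)

  tope : ∃ (Face 3)
  tope = let (T , cT , p) = proj₁ hasRank in T , cT , p

  sgn-face : ∀ {i X} → Face i X → sgn X ≡ signed i
  sgn-face (cX , refl) = sgn-cov cX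

  Count : ℕ → (SV n → ℤ) → ℤ
  Count i = Weighted (r i)

  Count-cong : ∀ i {φ ψ} → (∀ X → Face i X → φ X ≡ ψ X) → Count i φ ≡ Count i ψ
  Count-cong i p = ∑-cong λ X → 𝟙-guard (face? i X) (p X)

  Count-0 : ∀ i {φ} → (∀ X → Face i X → φ X ≡ 0ℤ) → Count i φ ≡ 0ℤ
  Count-0 i p = ∑-0 λ X → trans (𝟙-guard (face? i X) (p X)) (ℤₚ.*-zeroʳ (r i X))

  Count-1 : ∀ i {φ Y} → Face i Y → (∀ X → Face i X → φ X ≡ 𝟙 (X ≟ Y)) → Count i φ ≡ 1ℤ
  Count-1 i {Y = Y} fY p = trans (Count-cong i p)
    (trans (Weighted-δ₁ (r i) Y) (𝟙-yes (face? i Y) fY))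

  Count-mono : ∀ i {φ ψ} → (∀ X → Face i X → φ X ≤ ψ X) → Count i φ ≤ Count i ψ
  Count-mono i {φ} {ψ} p = ∑-mono λ X → guarded X (face? i X)
    where
    guarded : ∀ X (d : Dec (Face i X)) → 𝟙 d * φ X ≤ 𝟙 d * ψ X
    guarded X (yes f) = ℤₚ.≤-trans (ℤₚ.≤-reflexive (ℤₚ.*-identityˡ (φ X)))
      (ℤₚ.≤-trans (p X f) (ℤₚ.≤-reflexive (sym (ℤₚ.*-identityˡ (ψ X)))))
    guarded X (no _)  = ℤₚ.≤-refl

  Count-neg : ∀ i φ → Count i (φ ∘ negV) ≡ Count i φ
  Count-neg i φ = trans
    (∑-cong λ X → cong (_* φ (negV X)) (𝟙-cong (face? i X) (face? i (negV X)) face-neg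
      (λ f → subst (Face i) (neg-involutive X) (face-neg f))))
    (∑-neg (λ X → r i X * φ X))

  alternating : ∀ φ → Weighted sgn φ ≡ Count 0 φ - Count 1 φ + (Count 2 φ - Count 3 φ)
  alternating φ = trans (∑-cong λ X → trans
      (cong (_* φ X) (split (cov? X) (rank M X) rank-≤3))
      (expand (r 0 X) (r 1 X) (r 2 X) (r 3 X) (φ X)))
    (trans (∑-+₃ (λ X → r 0 X * φ X) (λ X → -1ℤ * (r 1 X * φ X))
             (λ X → r 2 X * φ X + -1ℤ * (r 3 X * φ X)))
    (trans (cong₂ (λ s t → Count 0 φ + (s + t)) (∑-*ˡ -1ℤ (λ X → r 1 X * φ X))
        (trans (∑-+ (λ X → r 2 X * φ X) (λ X → -1ℤ * (r 3 X * φ X)))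
          (cong (Count 2 φ +_) (∑-*ˡ -1ℤ (λ X → r 3 X * φ X)))))
      (collect (Count 0 φ) (Count 1 φ) (Count 2 φ) (Count 3 φ))))
    where
    split : ∀ {P : Set} (d : Dec P) k → (P → k ℕ.≤ 3) → 𝟙 d * signed k ≡
      𝟙 (d ×-dec (k ℕ.≟ 0)) + (-1ℤ * 𝟙 (d ×-dec (k ℕ.≟ 1)) +
        (𝟙 (d ×-dec (k ℕ.≟ 2)) + -1ℤ * 𝟙 (d ×-dec (k ℕ.≟ 3))))
    split (no _)  k _ = refl
    split (yes _) 0 _ = refl
    split (yes _) 1 _ = refl
    split (yes _) 2 _ = refl
    split (yes _) 3 _ = refl
    split (yes p) (suc (suc (suc (suc k)))) ≤3 with ≤3 p
    ... | s≤s (s≤s (s≤s ()))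

    expand : ∀ a b c d x → (a + (-1ℤ * b + (c + -1ℤ * d))) * x ≡
                           a * x + (-1ℤ * (b * x) + (c * x + -1ℤ * (d * x)))
    expand = solve-∀

    collect : ∀ a b c d → a + (-1ℤ * b + (c + -1ℤ * d)) ≡ a - b + (c - d)
    collect = solve-∀

  f : ℕ → ℤ
  f i = Count i (λ _ → 1ℤ)

  between : ℕ → SV n → SV n → ℤ
  between i A G = Count i (λ F → 𝟙 ((A ≼? F) ×-dec (F ≼? G)))

  above below supported : ℕ → SV n → ℤ
  above     i A = Count i (λ F → 𝟙 (A ≼? F))
  below     i G = Count i (λ F → 𝟙 (F ≼? G))
  supported i G = Count i (λ F → 𝟙 (F ⊑? G))

  between-bottom : ∀ {i A G} → Face i A → A ≼ G → between i A G ≡ 1ℤ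
  between-bottom {i} {A} {G} fA A≼G = Count-1 i fA λ F fF →
    𝟙-cong ((A ≼? F) ×-dec (F ≼? G)) (F ≟ A)
      (λ (p , _) → sym (same-rank fA fF p)) (λ { refl → ≼-refl , A≼G })

  between-top : ∀ {i A G} → Face i G → A ≼ G → between i A G ≡ 1ℤ
  between-top {i} {A} {G} fG A≼G = Count-1 i fG λ F fF →
    𝟙-cong ((A ≼? F) ×-dec (F ≼? G)) (F ≟ G)
      (λ (_ , p) → same-rank fF fG p) (λ { refl → A≼G , ≼-refl })

  between-under : ∀ {i j A G} → Face j A → i ℕ.< j → between i A G ≡ 0ℤ
  between-under {i} {A = A} {G} fA i<j = Count-0 i λ F fF →
    𝟙-no ((A ≼? F) ×-dec (F ≼? G)) λ (p , _) → ℕₚ.<⇒≱ i<j (face-rank-≤ fA fF p)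

  between-over : ∀ {i j A G} → Face j G → j ℕ.< i → between i A G ≡ 0ℤ
  between-over {i} {A = A} {G} fG j<i = Count-0 i λ F fF →
    𝟙-no ((A ≼? F) ×-dec (F ≼? G)) λ (_ , p) → ℕₚ.<⇒≱ j<i (face-rank-≤ fF fG p)

  between-0 : ∀ i G → between i zeroV G ≡ below i G
  between-0 i G = Count-cong i λ F _ →
    𝟙-cong ((zeroV ≼? F) ×-dec (F ≼? G)) (F ≼? G) proj₂ (λ p → 0≼ F , p)

  above-bottom : ∀ {i A} → Face i A → above i A ≡ 1ℤ
  above-bottom {i} {A} fA = Count-1 i fA λ F fF →
    𝟙-cong (A ≼? F) (F ≟ A) (λ p → sym (same-rank fA fF p)) (λ { refl → ≼-refl })

  above-under : ∀ {i j A} → Face j A → i ℕ.< j → above i A ≡ 0ℤ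
  above-under {i} {A = A} fA i<j = Count-0 i λ F fF →
    𝟙-no (A ≼? F) λ p → ℕₚ.<⇒≱ i<j (face-rank-≤ fA fF p)

  f-0 : f 0 ≡ 1ℤ
  f-0 = Count-1 0 face-0 λ F (_ , p) → sym (𝟙-yes (F ≟ zeroV) (rank≡0 p))

  -- Every covector is supported in a tope, so this is the support relation at a tope, whose sign is
  -- that of rank 3.
  sgn-total : ∑ sgn ≡ -1ℤ
  sgn-total = trans
    (∑-cong λ F → trans (sym (ℤₚ.*-identityʳ (sgn F)))
      (sgn-guard F λ cF → sym (𝟙-yes (F ⊑? proj₁ tope) (tope-⊒ (proj₂ tope) cF))))
    (trans (euler-support (proj₁ (proj₂ tope))) (sgn-face (proj₂ tope)))

  euler : f 1 ≡ ℤ.+ 2 + f 2 - f 3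
  euler = solve (f 0) (f 1) (f 2) (f 3) f-0
    (trans (sym (alternating (λ _ → 1ℤ))) (trans (∑-cong λ F → ℤₚ.*-identityʳ (sgn F)) sgn-total))
    where
    -- As in the later `solve` helpers, the counts become variables and the relation `p` is
    -- substituted into a ring identity that contains its left side.
    rearrange : ∀ b c d → b ≡ 1ℤ + c - d - (1ℤ - b + (c - d))
    rearrange = solve-∀
    simplify : ∀ c d → 1ℤ + c - d - -1ℤ ≡ ℤ.+ 2 + c - d
    simplify = solve-∀
    solve : ∀ a b c d → a ≡ 1ℤ → a - b + (c - d) ≡ -1ℤ → b ≡ ℤ.+ 2 + c - d
    solve .1ℤ b c d refl p = trans (rearrange b c d)
      (trans (cong (1ℤ + c - d -_) p) (simplify c d))

  interval : ∀ {A G} → Cov A → Cov G → A ≼ G → A ≢ G →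
    between 0 A G - between 1 A G + (between 2 A G - between 3 A G) ≡ 0ℤ
  interval {A} {G} cA cG A≼G A≢G =
    trans (sym (alternating (λ F → 𝟙 ((A ≼? F) ×-dec (F ≼? G))))) (euler-interval cA cG A≼G A≢G)

  face-≢ : ∀ {i j X Y} → Face i X → Face j Y → i ≢ j → X ≢ Y
  face-≢ (_ , p) (_ , q) i≢j refl = i≢j (trans (sym p) q)

  -- In the relation for the interval from the zero covector to `D`, the two ends cancel because
  -- their ranks differ by 3.
  vertices≡edges : ∀ {D} → Face 3 D → below 1 D ≡ below 2 D
  vertices≡edges {D} fD = solve _ _ _ _
    (between-bottom face-0 (0≼ D)) (between-top fD (0≼ D)) (between-0 1 D) (between-0 2 D)
    (interval (V0 M) (proj₁ fD) (0≼ D) (face-≢ face-0 fD λ ()))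
    where
    rearrange : ∀ b c → b ≡ c - (1ℤ - b + (c - 1ℤ)) + 0ℤ
    rearrange = solve-∀
    simplify : ∀ c → c - 0ℤ + 0ℤ ≡ c
    simplify = solve-∀
    solve : ∀ a b c d {b′ c′} → a ≡ 1ℤ → d ≡ 1ℤ → b ≡ b′ → c ≡ c′ → a - b + (c - d) ≡ 0ℤ → b′ ≡ c′
    solve .1ℤ b c .1ℤ refl refl refl refl p = trans (rearrange b c)
      (trans (cong (λ s → c - s + 0ℤ) p) (simplify c))

  edge-vertices : ∀ {e} → Face 2 e → below 1 e ≡ ℤ.+ 2
  edge-vertices {e} fe = solve _ _ _ _
    (between-bottom face-0 (0≼ e)) (between-top fe (0≼ e))
    (between-over {3} {A = zeroV} fe ℕₚ.≤-refl) (between-0 1 e)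
    (interval (V0 M) (proj₁ fe) (0≼ e) (face-≢ face-0 fe λ ()))
    where
    rearrange : ∀ b → b ≡ ℤ.+ 2 - (1ℤ - b + (1ℤ - 0ℤ))
    rearrange = solve-∀
    solve : ∀ a b c d {b′} → a ≡ 1ℤ → c ≡ 1ℤ → d ≡ 0ℤ → b ≡ b′ → a - b + (c - d) ≡ 0ℤ → b′ ≡ ℤ.+ 2
    solve .1ℤ b .1ℤ .0ℤ refl refl refl refl p = trans (rearrange b) (cong (ℤ.+ 2 -_) p)

  corner-edges : ∀ {v D} → Face 1 v → Face 3 D → v ≼ D → between 2 v D ≡ ℤ.+ 2
  corner-edges {v} {D} fv fD v≼D = solve _ _ _ _
    (between-under {0} {G = D} fv ℕₚ.≤-refl) (between-bottom fv v≼D) (between-top fD v≼D)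
    (interval (proj₁ fv) (proj₁ fD) v≼D (face-≢ fv fD λ ()))
    where
    rearrange : ∀ c → c ≡ ℤ.+ 2 + (0ℤ - 1ℤ + (c - 1ℤ))
    rearrange = solve-∀
    solve : ∀ a b c d → a ≡ 0ℤ → b ≡ 1ℤ → d ≡ 1ℤ → a - b + (c - d) ≡ 0ℤ → c ≡ ℤ.+ 2
    solve .0ℤ .1ℤ c .1ℤ refl refl refl p = trans (rearrange c) (cong (ℤ.+ 2 +_) p)

  -- Above `e` lie only `e` itself, with sign 1, and topes, with sign -1; by `euler-above` the total
  -- is -1.
  edge-topes : ∀ {e} → Face 2 e → above 3 e ≡ ℤ.+ 2
  edge-topes {e} fe = solve _ _ _ _
    (above-under {0} fe (s≤s z≤n)) (above-under {1} fe ℕₚ.≤-refl) (above-bottom fe)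
    (trans (sym (alternating (λ F → 𝟙 (e ≼? F)))) (trans (euler-above (proj₁ fe)) sgn-total))
    where
    rearrange : ∀ d → d ≡ 1ℤ - (0ℤ - 0ℤ + (1ℤ - d))
    rearrange = solve-∀
    solve : ∀ a b c d → a ≡ 0ℤ → b ≡ 0ℤ → c ≡ 1ℤ → a - b + (c - d) ≡ -1ℤ → d ≡ ℤ.+ 2
    solve .0ℤ .0ℤ .1ℤ d refl refl refl p = trans (rearrange d) (cong (1ℤ -_) p)

  no-topes : ∀ {e} → Face 2 e → supported 3 e ≡ 0ℤ
  no-topes {e} fe = Count-0 3 λ F fF → 𝟙-no (F ⊑? e) λ F⊑e →
    contradiction (trans (sym (proj₂ fF)) (trans
      (rank-support (proj₁ fF) (proj₁ fe) F⊑e (tope-⊒ fF (proj₁ fe))) (proj₂ fe))) λ ()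

  -- The faces supported in `e` form its great circle. The support relation has the zero covector on
  -- one side and the sign of `e` on the other, both equal to 1.
  line-balanced : ∀ {e} → Face 2 e → supported 1 e ≡ supported 2 e
  line-balanced {e} fe = solve _ _ _ _
    (Count-1 0 face-0 λ F (cF , p) → 𝟙-cong (F ⊑? e) (F ≟ zeroV)
      (λ _ → rank≡0 p) (λ { refl → ≼⇒⊑ (0≼ e) }))
    (no-topes fe)
    (trans (sym (alternating (λ F → 𝟙 (F ⊑? e)))) (trans (euler-support (proj₁ fe)) (sgn-face fe)))
    where
    rearrange : ∀ b c → b ≡ 1ℤ + c - (1ℤ - b + (c - 0ℤ))
    rearrange = solve-∀
    simplify : ∀ c → 1ℤ + c - 1ℤ ≡ c
    simplify = solve-∀
    solve : ∀ a b c d → a ≡ 1ℤ → d ≡ 0ℤ → a - b + (c - d) ≡ 1ℤ → b ≡ c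
    solve .1ℤ b c .0ℤ refl refl p = trans (rearrange b c)
      (trans (cong (1ℤ + c -_) p) (simplify c))

-- Products of the rank sums and their commutators

module Products {n : ℕ} (M : OrientedMatroid n) (hasRank : HasRank M 3) where
  open Covectors M
  open Rank M
  open FaceSums M
  open RankThree M hasRank

  product : ℕ → ℕ → SV n → ℤ
  product i j Z = Count i (λ X → Count j (λ Y → 𝟙 ((X ∘ᵥ Y) ≟ Z)))

  Count-rank-0 : ∀ φ → Count 0 φ ≡ φ zeroV
  Count-rank-0 φ = trans
    (Count-cong 0 λ X (_ , p) → trans (sym (ℤₚ.*-identityˡ (φ X)))
      (cong (_* φ X) (sym (𝟙-yes (X ≟ zeroV) (rank≡0 p)))))
    (trans (Weighted-δ (r 0) φ zeroV)
      (trans (cong (_* φ zeroV) (𝟙-yes (face? 0 zeroV) face-0)) (ℤₚ.*-identityˡ (φ zeroV))))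

  product-0 : ∀ j Z → product 0 j Z ≡ r j Z
  product-0 j Z = trans (Count-rank-0 (λ X → Count j (λ Y → 𝟙 ((X ∘ᵥ Y) ≟ Z))))
    (trans (Count-cong j λ Y _ → 𝟙-cong ((zeroV ∘ᵥ Y) ≟ Z) (Y ≟ Z)
        (trans (sym (0≼ Y))) (trans (0≼ Y)))
      (Weighted-δ₁ (r j) Z))

  product-3 : ∀ j Z → product 3 j Z ≡ r 3 Z * f j
  product-3 j Z = trans
    (Count-cong 3 λ X fX → trans
      (Count-cong j λ Y fY → trans
        (𝟙-cong ((X ∘ᵥ Y) ≟ Z) (X ≟ Z) (trans (sym (tope-⊒ fX (proj₁ fY))))
          (trans (tope-⊒ fX (proj₁ fY))))
        (sym (ℤₚ.*-identityʳ (𝟙 (X ≟ Z)))))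
      (Weighted-*ˡ (𝟙 (X ≟ Z)) (r j) (λ _ → 1ℤ)))
    (Weighted-δ (r 3) (λ _ → f j) Z)

  -- The signed sum of all covectors times σⱼ, computed twice: by the rank of the left factor, where
  -- ranks 0 and 3 are explicit, and by `face-sum`, where negating `X` turns the condition into
  -- `X ≼ Z`.
  product-row : ∀ j Z → r j Z - product 1 j Z + (product 2 j Z - r 3 Z * f j) ≡ sgn Z * below j Z
  product-row j Z = trans
    (cong₂ (λ s t → s - product 1 j Z + (product 2 j Z - t)) (sym (product-0 j Z)) (sym (product-3 j Z)))
    (trans (sym (alternating (λ F → Count j (λ X → 𝟙 ((F ∘ᵥ X) ≟ Z)))))
    (trans (Weighted-swap sgn (r j) (λ F X → 𝟙 ((F ∘ᵥ X) ≟ Z)))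
    (trans (Count-cong j λ X fX → face-sum (proj₁ fX) Z)
    (trans (Weighted-*ˡ (sgn Z) (r j) (λ X → 𝟙 (X ≼? negV Z)))
      (cong (sgn Z *_) (trans (sym (Count-neg j (λ X → 𝟙 (X ≼? negV Z))))
        (Count-cong j λ X _ → 𝟙-cong (negV X ≼? negV Z) (X ≼? Z)
          (by-signs (X ∷ Z ∷ []) (⊖ x₀ ≼ₜ ⊖ x₁ ∷ []) (x₀ ≼ₜ x₁))
          (by-signs (X ∷ Z ∷ []) (x₀ ≼ₜ x₁ ∷ []) (⊖ x₀ ≼ₜ ⊖ x₁)))))))))

  sgn-below-3 : ∀ Z → sgn Z * below 3 Z ≡ r 3 Z * -1ℤ
  sgn-below-3 Z = trans
    (sgn-guard Z λ cZ → trans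
      (Count-cong 3 λ X fX → 𝟙-cong (X ≼? Z) (X ≟ Z) (tope-maximal fX cZ) (λ { refl → ≼-refl }))
      (Weighted-δ₁ (r 3) Z))
    (trans (ℤₚ.*-comm (sgn Z) (r 3 Z)) (𝟙-guard (face? 3 Z) sgn-face))

  -- The row for `j = 3` gives σ₁σ₃ in terms of σ₂σ₃. The correction it contains is cancelled at a
  -- tope by `f 1 - f 2`, which is `2 - f 3` by Euler's formula.
  commutator-13≡23 : ∀ Z → product 1 3 Z - product 3 1 Z ≡ product 2 3 Z - product 3 2 Z
  commutator-13≡23 Z = trans (cong (product 1 3 Z -_) (product-3 1 Z))
    (trans (solve (r 3 Z) (f 1) (f 2) (f 3) (product 1 3 Z) (product 2 3 Z) euler
             (trans (product-row 3 Z) (sgn-below-3 Z)))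
      (cong (product 2 3 Z -_) (sym (product-3 2 Z))))
    where
    rearrange : ∀ t c d x y → x - t * (ℤ.+ 2 + c - d) ≡
                y - t * c + (t * -1ℤ - (t - x + (y - t * d)))
    rearrange = solve-∀
    simplify : ∀ t c y → y - t * c + (t * -1ℤ - t * -1ℤ) ≡ y - t * c
    simplify = solve-∀
    solve : ∀ t b c d x y → b ≡ ℤ.+ 2 + c - d → t - x + (y - t * d) ≡ t * -1ℤ → x - t * b ≡ y - t * c
    solve t _ c d x y refl p = trans (rearrange t c d x y)
      (trans (cong (λ s → y - t * c + (t * -1ℤ - s)) p) (simplify t c y))

  edge-maximal : ∀ {e Z} → Face 2 e → Cov Z → ¬ Face 3 Z → e ≼ Z → e ≡ Z
  edge-maximal {e} {Z} fe cZ ¬fZ e≼Z = same-rank fe (cZ , rank-2 _ refl) e≼Z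
    where
    rank-2 : ∀ k → rank M Z ≡ k → rank M Z ≡ 2
    rank-2 k p with ℕₚ.m≤n⇒m<n∨m≡n (face-rank-≤ fe (cZ , refl) e≼Z)
    ... | inj₁ 2< = contradiction (cZ , ℕₚ.≤-antisym (rank-≤3 cZ) 2<) ¬fZ
    ... | inj₂ 2≡ = sym 2≡

  product-2-nontope : ∀ j {Z} → ¬ Face 3 Z → product 2 j Z ≡ r 2 Z * supported j Z
  product-2-nontope j {Z} ¬fZ = trans
    (Count-cong 2 λ e fe → trans
      (Count-cong j λ Y fY → trans
        (𝟙-cong ((e ∘ᵥ Y) ≟ Z) ((e ≟ Z) ×-dec (Y ⊑? Z))
          (λ { refl → let e≡ = edge-maximal fe (cov-∘ (proj₁ fe) (proj₁ fY)) ¬fZ (x≼x∘y e Y) in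
                 e≡ , subst (Y ⊑_) e≡ (sym e≡) })
          (λ { (refl , p) → p }))
        (𝟙-× (e ≟ Z) (Y ⊑? Z)))
      (Weighted-*ˡ (𝟙 (e ≟ Z)) (r j) (λ Y → 𝟙 (Y ⊑? Z))))
    (Weighted-δ (r 2) (λ _ → supported j Z) Z)

  product-3-nontope : ∀ j {Z} → ¬ Face 3 Z → product 3 j Z ≡ 0ℤ
  product-3-nontope j {Z} ¬fZ = trans (product-3 j Z) (cong (_* f j) (𝟙-no (face? 3 Z) ¬fZ))

  product-i3-nontope : ∀ i {Z} → ¬ Face 3 Z → product i 3 Z ≡ 0ℤ
  product-i3-nontope i {Z} ¬fZ = Count-0 i λ X fX → Count-0 3 λ Y fY →
    𝟙-no ((X ∘ᵥ Y) ≟ Z) λ { refl → ¬fZ (tope-∘ (proj₁ fX) fY) }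

  -- Away from the topes the row for `j = 2` reduces to equality of the coefficients of σ₁σ₂ and
  -- σ₂σ₂. At an edge the latter counts the edges of its great circle, and σ₂σ₁ counts the vertices.
  products-12-nontope : ∀ {Z} → ¬ Face 3 Z → product 1 2 Z ≡ product 2 1 Z
  products-12-nontope {Z} ¬fZ = trans
    (solve (r 2 Z) (r 3 Z) (f 2) (product 1 2 Z) (product 2 2 Z) (𝟙-no (face? 3 Z) ¬fZ)
      (trans (product-row 2 Z) sgn-below-2))
    (trans (product-2-nontope 2 ¬fZ)
      (trans (𝟙-guard (face? 2 Z) (λ fZ → sym (line-balanced fZ))) (sym (product-2-nontope 1 ¬fZ))))
    where
    sgn-below-2 : sgn Z * below 2 Z ≡ r 2 Z
    sgn-below-2 = trans
      (sgn-guard Z λ cZ → trans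
        (Count-cong 2 λ X fX → 𝟙-cong (X ≼? Z) (X ≟ Z) (edge-maximal fX cZ ¬fZ) (λ { refl → ≼-refl }))
        (Weighted-δ₁ (r 2) Z))
      (trans (ℤₚ.*-comm (sgn Z) (r 2 Z)) (trans (𝟙-guard (face? 2 Z) sgn-face) (ℤₚ.*-identityʳ (r 2 Z))))

    rearrange : ∀ t c x y → x ≡ y + t - (t - x + (y - 0ℤ * c))
    rearrange = solve-∀
    simplify : ∀ t y → y + t - t ≡ y
    simplify = solve-∀
    solve : ∀ t u c x y → u ≡ 0ℤ → t - x + (y - u * c) ≡ t → x ≡ y
    solve t .0ℤ c x y refl p = trans (rearrange t c x y) (trans (cong (y + t -_) p) (simplify t y))

  -- Composing with − Y instead of Y exchanges the two topes at an edge.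
  edge-sides : ∀ j {e D} → Face 2 e → Face 3 D →
    ℤ.+ 2 * Count j (λ Y → 𝟙 ((e ∘ᵥ Y) ≟ D)) ≡ 𝟙 (e ≼? D) * (f j - supported j e)
  edge-sides j {e} {D} fe fD = cases (e ≼? D)
    where
    c = Count j (λ Y → 𝟙 ((e ∘ᵥ Y) ≟ D))

    rearrange : ∀ c s → ℤ.+ 2 * c ≡ 1ℤ * (c + (c + s) - s)
    rearrange = solve-∀

    cases : (d : Dec (e ≼ D)) → ℤ.+ 2 * c ≡ 𝟙 d * (f j - supported j e)
    cases (no e⋠D) = cong (ℤ.+ 2 *_) (Count-0 j λ Y _ →
      𝟙-no ((e ∘ᵥ Y) ≟ D) λ { refl → e⋠D (x≼x∘y e Y) })
    -- The faces `Y` leading to `D`, those whose negative leads to `D`, and those supported in `e`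
    -- exhaust all faces of rank `j` without overlap; the first two classes have equal size.
    cases (yes e≼D) = trans (rearrange c (supported j e))
      (cong (λ s → 1ℤ * (s - supported j e)) (trans
        (cong (λ s → c + (s + supported j e)) (sym (Count-neg j (λ Y → 𝟙 ((e ∘ᵥ Y) ≟ D)))))
        (trans (sym (trans
            (Weighted-+ (r j) (λ Y → 𝟙 ((e ∘ᵥ Y) ≟ D))
              (λ Y → 𝟙 ((e ∘ᵥ negV Y) ≟ D) + 𝟙 (Y ⊑? e)))
            (cong (c +_) (Weighted-+ (r j) (λ Y → 𝟙 ((e ∘ᵥ negV Y) ≟ D)) (λ Y → 𝟙 (Y ⊑? e))))))
          (Count-cong j λ Y fY → side Y
            (facet-sides (proj₁ fD) e⋖D (proj₁ fY) (tope-⊒ fD (proj₁ fY)))))))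
      where
      e⋖D = face-⋖ fe fD e≼D

      e≢D : e ≢ D
      e≢D = face-≢ fe fD λ ()

      -- The three alternatives of facet-sides exclude each other.
      side : ∀ Y → e ∘ᵥ Y ≡ e ⊎ e ∘ᵥ Y ≡ D ⊎ e ∘ᵥ Y ≡ e ∘ᵥ negV D →
        𝟙 ((e ∘ᵥ Y) ≟ D) + (𝟙 ((e ∘ᵥ negV Y) ≟ D) + 𝟙 (Y ⊑? e)) ≡ 1ℤ
      side Y (inj₁ p) = cong₂ _+_
        (𝟙-no ((e ∘ᵥ Y) ≟ D) λ q → e≢D (trans (sym p) q))
        (cong₂ _+_ (𝟙-no ((e ∘ᵥ negV Y) ≟ D) λ q → e≢D
            (by-signs (e ∷ D ∷ Y ∷ []) (x₀ ∙ x₂ ≈ x₀ ∷ x₀ ∙ ⊖ x₂ ≈ x₁ ∷ []) (x₀ ≈ x₁) p q))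
          (𝟙-yes (Y ⊑? e) p))
      side Y (inj₂ (inj₁ p)) = cong₂ _+_ (𝟙-yes ((e ∘ᵥ Y) ≟ D) p)
        (cong₂ _+_ (𝟙-no ((e ∘ᵥ negV Y) ≟ D) λ q → e≢D
            (by-signs (e ∷ D ∷ Y ∷ []) (x₀ ∙ x₂ ≈ x₁ ∷ x₀ ∙ ⊖ x₂ ≈ x₁ ∷ []) (x₀ ≈ x₁) p q))
          (𝟙-no (Y ⊑? e) λ q → e≢D (trans (sym q) p)))
      side Y (inj₂ (inj₂ p)) = cong₂ _+_
        (𝟙-no ((e ∘ᵥ Y) ≟ D) λ q → e≢D
            (by-signs (e ∷ D ∷ Y ∷ []) (x₀ ∙ x₂ ≈ x₀ ∙ ⊖ x₁ ∷ x₀ ∙ x₂ ≈ x₁ ∷ []) (x₀ ≈ x₁) p q))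
        (cong₂ _+_ (𝟙-yes ((e ∘ᵥ negV Y) ≟ D)
            (by-signs (e ∷ D ∷ Y ∷ []) (x₀ ≼ₜ x₁ ∷ x₀ ∙ x₂ ≈ x₀ ∙ ⊖ x₁ ∷ []) (x₀ ∙ ⊖ x₂ ≈ x₁) e≼D p))
          (𝟙-no (Y ⊑? e) λ q → e≢D
            (by-signs (e ∷ D ∷ Y ∷ []) (x₀ ≼ₜ x₁ ∷ x₀ ∙ x₂ ≈ x₀ ∙ ⊖ x₁ ∷ x₀ ∙ x₂ ≈ x₀ ∷ [])
              (x₀ ≈ x₁) e≼D p q)))

  product-2-tope : ∀ j {D} → Face 3 D →
    ℤ.+ 2 * product 2 j D ≡ Count 2 (λ e → 𝟙 (e ≼? D) * (f j - supported j e))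
  product-2-tope j {D} fD = trans
    (sym (Weighted-*ˡ (ℤ.+ 2) (r 2) (λ e → Count j (λ Y → 𝟙 ((e ∘ᵥ Y) ≟ D)))))
    (Count-cong 2 λ e fe → edge-sides j fe fD)

  commutator-23 : ∀ {D} → Face 3 D →
    ℤ.+ 2 * (product 2 3 D - product 3 2 D) ≡ below 2 D * f 3 - ℤ.+ 2 * f 2
  commutator-23 {D} fD = solve (product 2 3 D) (product 3 2 D) (f 2) (below 2 D * f 3)
    (trans (product-2-tope 3 fD) (trans
      (Count-cong 2 λ e fe → cong (𝟙 (e ≼? D) *_)
        (trans (cong (f 3 -_) (no-topes fe)) (ℤₚ.+-identityʳ (f 3))))
      (Weighted-*ʳ (f 3) (r 2) (λ e → 𝟙 (e ≼? D)))))
    (trans (product-3 2 D) (trans (cong (_* f 2) (𝟙-yes (face? 3 D) fD)) (ℤₚ.*-identityˡ (f 2))))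
    where
    distrib : ∀ x z → ℤ.+ 2 * (x - z) ≡ ℤ.+ 2 * x - ℤ.+ 2 * z
    distrib = solve-∀
    solve : ∀ x y z w → ℤ.+ 2 * x ≡ w → y ≡ z → ℤ.+ 2 * (x - y) ≡ w - ℤ.+ 2 * z
    solve x y z w p refl = trans (distrib x z) (cong (_- ℤ.+ 2 * z) p)

  -- The row for `j = 2` replaces σ₁σ₂ by σ₂σ₂. Since great circles are balanced, each edge of `D`
  -- contributes to twice the coefficients of σ₂σ₂ and σ₂σ₁ amounts differing by `f 2 - f 1`, and
  -- Euler's formula does the rest.
  commutator-12 : ∀ {D} → Face 3 D →
    ℤ.+ 2 * (product 1 2 D - product 2 1 D) ≡ below 2 D * f 3 - ℤ.+ 2 * f 2
  commutator-12 {D} fD = solve (product 1 2 D) (product 2 1 D) (product 2 2 D) (below 2 D)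
    (f 1) (f 2) (f 3) (r 2 D) (r 3 D) (sgn D) euler
    (𝟙-no (face? 2 D) λ (_ , p) → contradiction (trans (sym p) (proj₂ fD)) λ ())
    (𝟙-yes (face? 3 D) fD) (sgn-face fD) (product-row 2 D) difference
    where
    shift : ∀ t a b s → t * (b - s) ≡ t * (a - s) + t * (b - a)
    shift = solve-∀

    difference : ℤ.+ 2 * product 2 2 D ≡ ℤ.+ 2 * product 2 1 D + below 2 D * (f 2 - f 1)
    difference = trans (product-2-tope 2 fD) (trans
      (Count-cong 2 λ e fe → trans (cong (λ s → 𝟙 (e ≼? D) * (f 2 - s)) (sym (line-balanced fe)))
        (shift (𝟙 (e ≼? D)) (f 1) (f 2) (supported 1 e)))
      (trans (Weighted-+ (r 2) (λ e → 𝟙 (e ≼? D) * (f 1 - supported 1 e)) (λ e → 𝟙 (e ≼? D) * (f 2 - f 1)))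
        (cong₂ _+_ (sym (product-2-tope 1 fD)) (Weighted-*ʳ (f 2 - f 1) (r 2) (λ e → 𝟙 (e ≼? D))))))

    rearrange : ∀ x y z b c d → ℤ.+ 2 * (x - y) ≡
      ℤ.+ 2 * z - ℤ.+ 2 * y - ℤ.+ 2 * c - ℤ.+ 2 * (0ℤ - x + (z - 1ℤ * c))
    rearrange = solve-∀
    finish : ∀ y b c d → ℤ.+ 2 * y + b * (c - (ℤ.+ 2 + c - d)) - ℤ.+ 2 * y - ℤ.+ 2 * c - ℤ.+ 2 * (-1ℤ * b)
      ≡ b * d - ℤ.+ 2 * c
    finish = solve-∀
    solve : ∀ x y z b f₁ c d r₂ r₃ s → f₁ ≡ ℤ.+ 2 + c - d → r₂ ≡ 0ℤ → r₃ ≡ 1ℤ → s ≡ -1ℤ →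
      r₂ - x + (z - r₃ * c) ≡ s * b → ℤ.+ 2 * z ≡ ℤ.+ 2 * y + b * (c - f₁) →
      ℤ.+ 2 * (x - y) ≡ b * d - ℤ.+ 2 * c
    solve x y z b _ c d _ _ _ refl refl refl refl p q = trans (rearrange x y z b c d)
      (trans (cong₂ (λ u v → u - ℤ.+ 2 * y - ℤ.+ 2 * c - ℤ.+ 2 * v) q p) (finish y b c d))

  Commute : ℕ → ℕ → Set
  Commute i j = ∀ Z → product i j Z ≡ product j i Z

  -- Each edge lies in two topes, so this says that every tope has the average number of edges, with
  -- denominators cleared.
  Balanced : Set
  Balanced = ∀ D → Face 3 D → below 2 D * f 3 ≡ ℤ.+ 2 * f 2

  balanced⇒equal : ∀ {x y b c} → ℤ.+ 2 * (x - y) ≡ b - c → b ≡ c → x ≡ y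
  balanced⇒equal {x} {y} {b} p refl = ℤₚ.i-j≡0⇒i≡j x y
    (ℤₚ.*-cancelˡ-≡ (ℤ.+ 2) (x - y) 0ℤ (trans p (ℤₚ.+-inverseʳ b)))

  equal⇒balanced : ∀ {x y b c} → ℤ.+ 2 * (x - y) ≡ b - c → x ≡ y → b ≡ c
  equal⇒balanced {x} {_} {b} {c} p refl = ℤₚ.i-j≡0⇒i≡j b c
    (trans (sym p) (cong (ℤ.+ 2 *_) (ℤₚ.+-inverseʳ x)))

  commute-23⇔balanced : Commute 2 3 ⇔ Balanced
  commute-23⇔balanced = mk⇔ (λ h D fD → equal⇒balanced (commutator-23 fD) (h D))
    (λ b Z → cases b Z (face? 3 Z))
    where
    cases : Balanced → ∀ Z → Dec (Face 3 Z) → product 2 3 Z ≡ product 3 2 Z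
    cases b Z (yes fZ) = balanced⇒equal (commutator-23 fZ) (b Z fZ)
    cases b Z (no ¬fZ) = trans (product-i3-nontope 2 ¬fZ) (sym (product-3-nontope 2 ¬fZ))

  commute-12⇔balanced : Commute 1 2 ⇔ Balanced
  commute-12⇔balanced = mk⇔ (λ h D fD → equal⇒balanced (commutator-12 fD) (h D))
    (λ b Z → cases b Z (face? 3 Z))
    where
    cases : Balanced → ∀ Z → Dec (Face 3 Z) → product 1 2 Z ≡ product 2 1 Z
    cases b Z (yes fZ) = balanced⇒equal (commutator-12 fZ) (b Z fZ)
    cases b Z (no ¬fZ) = products-12-nontope ¬fZ

  commute-13⇔23 : Commute 1 3 ⇔ Commute 2 3
  commute-13⇔23 = mk⇔
    (λ h Z → ℤₚ.i-j≡0⇒i≡j (product 2 3 Z) (product 3 2 Z)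
      (trans (sym (commutator-13≡23 Z)) (ℤₚ.i≡j⇒i-j≡0 (h Z))))
    (λ h Z → ℤₚ.i-j≡0⇒i≡j (product 1 3 Z) (product 3 1 Z)
      (trans (commutator-13≡23 Z) (ℤₚ.i≡j⇒i-j≡0 (h Z))))

-- Integer counts as rational sums and as list lengths

-- The 0 stored in `mkℚ` is the denominator minus one. With this form the numerator gives
-- injectivity at once.
ι : ℤ → ℚ
ι z = mkℚ z 0 (Coprimality.sym (Coprimality.1-coprimeTo _))

ι-injective : ∀ {x y} → ι x ≡ ι y → x ≡ y
ι-injective = cong ↥_

ι-+ : ∀ x y → ι x ℚ.+ ι y ≡ ι (x + y)
ι-+ x y = ℚₚ.toℚᵘ-injective (ℚᵘₚ.≃-trans (ℚₚ.toℚᵘ-homo-+ (ι x) (ι y)) (ℚᵘ.*≡* (clear x y)))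
  where
  clear : ∀ x y → (x * 1ℤ + y * 1ℤ) * 1ℤ ≡ (x + y) * 1ℤ
  clear = solve-∀

sumℚ-++ : ∀ xs ys → sumℚ (xs List.++ ys) ≡ sumℚ xs ℚ.+ sumℚ ys
sumℚ-++ []       ys = sym (ℚₚ.+-identityˡ (sumℚ ys))
sumℚ-++ (x ∷ xs) ys = trans (cong (x ℚ.+_) (sumℚ-++ xs ys)) (sym (ℚₚ.+-assoc x (sumℚ xs) (sumℚ ys)))

sumℚ-map : (h : SV n → ℚ) (φ : SV n → ℤ) → (∀ X → h X ≡ ι (φ X)) →
           sumℚ (List.map h (allSV n)) ≡ ι (∑ φ)
sumℚ-map {n} h φ p = trans (go (allSV n)) (cong ι (∑-allSV φ))
  where
  go : ∀ Xs → sumℚ (List.map h Xs) ≡ ι (foldr (λ X s → φ X + s) 0ℤ Xs)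
  go []       = refl
  go (X ∷ Xs) = trans (cong₂ ℚ._+_ (p X) (go Xs)) (ι-+ (φ X) _)

sumℚ-concatMap : (h : SV n → List ℚ) (φ : SV n → ℤ) → (∀ X → sumℚ (h X) ≡ ι (φ X)) →
                 sumℚ (concatMap h (allSV n)) ≡ ι (∑ φ)
sumℚ-concatMap {n} h φ p = trans (go (allSV n)) (cong ι (∑-allSV φ))
  where
  go : ∀ Xs → sumℚ (concatMap h Xs) ≡ ι (foldr (λ X s → φ X + s) 0ℤ Xs)
  go []       = refl
  go (X ∷ Xs) = trans (sumℚ-++ (h X) (concatMap h Xs)) (trans (cong₂ ℚ._+_ (p X) (go Xs)) (ι-+ (φ X) _))

length-filter : (b : SV n → Bool) (φ : SV n → ℤ) → (∀ X → (if b X then 1ℤ else 0ℤ) ≡ φ X) →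
                ℤ.+ length (filter (λ X → T? (b X)) (allSV n)) ≡ ∑ φ
length-filter {n} b φ p = trans (go (allSV n)) (∑-allSV φ)
  where
  go : ∀ Xs → ℤ.+ length (filter (λ X → T? (b X)) Xs) ≡ foldr (λ X s → φ X + s) 0ℤ Xs
  go []       = refl
  go (X ∷ Xs) with b X | p X
  ... | true  | q = cong₂ _+_ q (go Xs)
  ... | false | q = trans (go Xs) (trans (sym (ℤₚ.+-identityˡ rest)) (cong (_+ rest) q))
    where rest = foldr (λ X s → φ X + s) 0ℤ Xs

-- Double counting and simpliciality

𝟙-overlap : ∀ {A B C E : Set} (a : Dec A) (b : Dec B) (c : Dec C) (e : Dec E) →
            (A → C) → (B → C) → (A → B → E) → 𝟙 a + 𝟙 b ≤ 𝟙 c + 𝟙 e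
𝟙-overlap (yes a) (yes b) (yes c) (yes e) f g h = ℤₚ.≤-refl
𝟙-overlap (yes a) (yes b) (no ¬c) e       f g h = contradiction (f a) ¬c
𝟙-overlap (yes a) (yes b) (yes c) (no ¬e) f g h = contradiction (h a b) ¬e
𝟙-overlap (yes a) (no _)  (no ¬c) e       f g h = contradiction (f a) ¬c
𝟙-overlap (yes a) (no _)  (yes c) (yes e) f g h = ℤ.+≤+ (s≤s z≤n)
𝟙-overlap (yes a) (no _)  (yes c) (no _)  f g h = ℤₚ.≤-refl
𝟙-overlap (no _)  (yes b) (no ¬c) e       f g h = contradiction (g b) ¬c
𝟙-overlap (no _)  (yes b) (yes c) (yes e) f g h = ℤ.+≤+ (s≤s z≤n)
𝟙-overlap (no _)  (yes b) (yes c) (no _)  f g h = ℤₚ.≤-refl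
𝟙-overlap (no _)  (no _)  (yes c) (yes e) f g h = ℤ.+≤+ z≤n
𝟙-overlap (no _)  (no _)  (yes c) (no _)  f g h = ℤ.+≤+ z≤n
𝟙-overlap (no _)  (no _)  (no _)  (yes e) f g h = ℤ.+≤+ z≤n
𝟙-overlap (no _)  (no _)  (no _)  (no _)  f g h = ℤₚ.≤-refl

module DoubleCounting {n : ℕ} (M : OrientedMatroid n) (hasRank : HasRank M 3) where
  open Covectors M
  open Rank M
  open RankThree M hasRank
  open Products M hasRank

  topes-edges : Count 3 (below 2) ≡ ℤ.+ 2 * f 2
  topes-edges = trans (Weighted-swap (r 3) (r 2) (λ D e → 𝟙 (e ≼? D)))
    (trans (Count-cong 2 λ e fe → edge-topes fe) (Weighted-*ˡ (ℤ.+ 2) (r 2) (λ _ → 1ℤ)))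

  vertices-edges : Count 1 (above 2) ≡ ℤ.+ 2 * f 2
  vertices-edges = trans (Weighted-swap (r 1) (r 2) (λ v e → 𝟙 (v ≼? e)))
    (trans (Count-cong 2 λ e fe → edge-vertices fe) (Weighted-*ˡ (ℤ.+ 2) (r 2) (λ _ → 1ℤ)))

  -- Two edges of a tope D at v, and two of the opposite tope v ∘ − D.
  vertex-degree : ∀ {v} → Face 1 v → ℤ.+ 4 ≤ above 2 v
  vertex-degree {v} fv = ℤₚ.≤-trans (ℤₚ.≤-reflexive (sym (trans
      (Weighted-+ (r 2) (λ F → 𝟙 ((v ≼? F) ×-dec (F ≼? D))) (λ F → 𝟙 ((v ≼? F) ×-dec (F ≼? D′))))
      (cong₂ _+_ (corner-edges fv fD (x≼x∘y v (proj₁ tope))) (corner-edges fv fD′ (x≼x∘y v (negV D)))))))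
    (Count-mono 2 λ F fF → ℤₚ.≤-trans
      -- The overlap is the empty type, decided by `no id`: a common face of `D` and `v ∘ᵥ negV D`
      -- lies below `v` and so is no edge.
      (𝟙-overlap ((v ≼? F) ×-dec (F ≼? D)) ((v ≼? F) ×-dec (F ≼? D′)) (v ≼? F) (no id) proj₁ proj₁
        λ (_ , F≼D) (_ , F≼D′) → ℕₚ.<⇒≱ (s≤s (s≤s z≤n)) (face-rank-≤ fF fv
          (by-signs (v ∷ D ∷ F ∷ []) (x₀ ≼ₜ x₁ ∷ x₂ ≼ₜ x₁ ∷ x₂ ≼ₜ x₀ ∙ ⊖ x₁ ∷ []) (x₂ ≼ₜ x₀)
            (x≼x∘y v (proj₁ tope)) F≼D F≼D′)))
      (ℤₚ.≤-reflexive (ℤₚ.+-identityʳ (𝟙 (v ≼? F)))))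
    where
    D   = v ∘ᵥ proj₁ tope
    fD  = tope-∘ (proj₁ fv) (proj₂ tope)
    D′  = v ∘ᵥ negV D
    fD′ = tope-∘ (proj₁ fv) (face-neg fD)

  other-edge : ∀ {v e D} → Face 1 v → Face 2 e → Face 3 D → v ≼ e → e ≼ D →
               ∃ λ e′ → Face 2 e′ × v ≼ e′ × e′ ≼ D × e′ ≢ e
  other-edge {v} {e} {D} fv fe fD v≼e e≼D
    with anySV? (λ e′ → face? 2 e′ ×-dec v ≼? e′ ×-dec e′ ≼? D ×-dec ¬? (e′ ≟ e))
  ... | yes found = found
  ... | no none = contradiction
    (trans (sym (corner-edges fv fD (≼-trans v≼e e≼D)))
      (Count-1 2 fe λ F fF → 𝟙-cong ((v ≼? F) ×-dec (F ≼? D)) (F ≟ e)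
        (λ (p , q) → decidable-stable (F ≟ e) λ F≢e → none (F , fF , p , q , F≢e))
        (λ { refl → v≼e , e≼D })))
    λ ()

  -- Two edges of D that meet in the vertex v have no other common vertex.
  three-vertices : ∀ {D} → Face 3 D → ℤ.+ 3 ≤ below 1 D
  three-vertices {D} fD =
    let (e , fe , e≼D)                = facet-exists fD
        (v , fv , v≼e)                = facet-exists fe
        (e′ , fe′ , v≼e′ , e′≼D , e′≢e) = other-edge fv fe fD v≼e e≼D
    in cancel (below 1 D) (ℤₚ.≤-trans
      (ℤₚ.≤-reflexive (sym (trans
        (Weighted-+ (r 1) (λ w → 𝟙 (w ≼? e)) (λ w → 𝟙 (w ≼? e′)))
        (cong₂ _+_ (edge-vertices fe) (edge-vertices fe′)))))
      (ℤₚ.≤-trans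
        (Count-mono 1 λ w fw → 𝟙-overlap (w ≼? e) (w ≼? e′) (w ≼? D) (w ≟ v)
          (λ p → ≼-trans p e≼D) (λ p → ≼-trans p e′≼D)
          (common fv fe fe′ v≼e v≼e′ e′≢e fw))
        (ℤₚ.≤-reflexive (trans
          (Weighted-+ (r 1) (λ w → 𝟙 (w ≼? D)) (λ w → 𝟙 (w ≟ v)))
          (cong (below 1 D +_) (trans (Weighted-δ₁ (r 1) v) (𝟙-yes (face? 1 v) fv)))))))
    where
    cancel : ∀ b → ℤ.+ 4 ≤ b + 1ℤ → ℤ.+ 3 ≤ b
    cancel b p = ℤₚ.≤-trans (ℤₚ.+-monoˡ-≤ -1ℤ p) (ℤₚ.≤-reflexive (drop b))
      where
      drop : ∀ b → b + 1ℤ + -1ℤ ≡ b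
      drop = solve-∀

    common : ∀ {v e e′ w} → Face 1 v → Face 2 e → Face 2 e′ → v ≼ e → v ≼ e′ → e′ ≢ e →
             Face 1 w → w ≼ e → w ≼ e′ → w ≡ v
    common {v} {e} {e′} {w} fv fe fe′ v≼e v≼e′ e′≢e fw w≼e w≼e′ with v ≟ (v ∘ᵥ w)
    ... | yes p = same-rank fw fv
      (by-signs (v ∷ e ∷ w ∷ []) (x₀ ≼ₜ x₁ ∷ x₂ ≼ₜ x₁ ∷ x₀ ≈ x₀ ∙ x₂ ∷ []) (x₂ ≼ₜ x₀) v≼e w≼e p)
    -- The composition of two different vertices of an edge lies strictly above the first and below
    -- the edge, hence equals the edge; `v` and `w` would span both `e` and `e′`.
    ... | no v≢ = contradiction (trans (sym (span fe′ v≼e′ w≼e′)) (span fe v≼e w≼e)) e′≢e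
      where
      span : ∀ {e} → Face 2 e → v ≼ e → w ≼ e → v ∘ᵥ w ≡ e
      span {e} fe v≼e w≼e = same-rank (cov-∘ (proj₁ fv) (proj₁ fw) , ℕₚ.≤-antisym
          (face-rank-≤ (cov-∘ (proj₁ fv) (proj₁ fw) , refl) fe below-e)
          (ℕₚ.≤-<-trans (ℕₚ.≤-reflexive (sym (proj₂ fv))) (rank-< (proj₁ fv) (x≼x∘y v w , v≢)))) fe below-e
        where
        below-e : (v ∘ᵥ w) ≼ e
        below-e = by-signs (v ∷ e ∷ w ∷ []) (x₀ ≼ₜ x₁ ∷ x₂ ≼ₜ x₁ ∷ []) (x₀ ∙ x₂ ≼ₜ x₁) v≼e w≼e

  f-nonNeg : ∀ i → 0ℤ ≤ f i
  f-nonNeg i = ℤₚ.≤-trans (ℤₚ.≤-reflexive (sym (Count-0 i λ _ _ → refl)))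
    (Count-mono i {ψ = λ _ → 1ℤ} λ _ _ → ℤ.+≤+ z≤n)

  Triangular : Set
  Triangular = ∀ D → Face 3 D → below 1 D ≡ ℤ.+ 3

  -- Three vertices mean three edges, so both sides count the incident pairs of an edge and a tope.
  triangular⇒balanced : Triangular → Balanced
  triangular⇒balanced t D fD = trans
    (cong (_* f 3) (trans (sym (vertices≡edges fD)) (t D fD)))
    (trans (sym (Weighted-*ˡ (ℤ.+ 3) (r 3) (λ _ → 1ℤ)))
      (trans (Count-cong 3 λ X fX → trans (sym (t X fX)) (vertices≡edges fX)) topes-edges))

  -- All topes have the average number 2 f₂ / f₃ of edges, and this is less than 4 because every
  -- vertex has degree at least 4.
  balanced⇒triangular : Balanced → Triangular
  balanced⇒triangular b D fD = ℤₚ.≤-antisym (ℤₚ.≮⇒≥ λ 3< → absurd (below 2 D) (f 1) (f 2) (f 3)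
      euler (f-nonNeg 3) (subst (ℤ.+ 4 ≤_) (vertices≡edges fD) (ℤₚ.i<j⇒suc[i]≤j 3<)) (b D fD) degrees)
    (three-vertices fD)
    where
    degrees : ℤ.+ 4 * f 1 ≤ ℤ.+ 2 * f 2
    degrees = ℤₚ.≤-trans (ℤₚ.≤-reflexive (sym (Weighted-*ˡ (ℤ.+ 4) (r 1) (λ _ → 1ℤ))))
      (ℤₚ.≤-trans (Count-mono 1 λ v fv → vertex-degree fv) (ℤₚ.≤-reflexive vertices-edges))

    -- If `D` had at least 4 edges, balance would give `4 f₃ ≤ 2 f₂`, and the degrees give
    -- `4 f₁ ≤ 2 f₂`. Added, they contradict `f₁ + f₃ = f₂ + 2` by 4 · 2 = 8, and `-[1+ 7 ]` is -8.
    eight : ∀ c d → (ℤ.+ 2 * c + ℤ.+ 2 * c) - (ℤ.+ 4 * d + ℤ.+ 4 * (ℤ.+ 2 + c - d)) ≡ ℤ.-[1+ 7 ]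
    eight = solve-∀

    absurd : ∀ k f₁ c d → f₁ ≡ ℤ.+ 2 + c - d → 0ℤ ≤ d → ℤ.+ 4 ≤ k → k * d ≡ ℤ.+ 2 * c →
             ℤ.+ 4 * f₁ ≤ ℤ.+ 2 * c → ⊥
    absurd k _ c d refl 0≤d 4≤k p q = contradiction
      (subst (0ℤ ≤_) (eight c d) (ℤₚ.i≤j⇒0≤j-i (ℤₚ.+-mono-≤
        (subst (ℤ.+ 4 * d ≤_) p (ℤₚ.*-monoʳ-≤-nonNeg d {{ℤ.nonNegative 0≤d}} 4≤k)) q)))
      λ ()

  cov?-does : ∀ X → does (cov? X) ≡ L M X
  cov?-does X with L M X
  ... | true  = refl
  ... | false = refl

  face-does : ∀ i X → (L M X ∧ (rank M X ℕ.≡ᵇ i)) ≡ does (face? i X)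
  face-does i X = cong (_∧ (rank M X ℕ.≡ᵇ i)) (sym (cov?-does X))

  numVertices-below : ∀ D → ℤ.+ numVertices M D ≡ below 1 D
  numVertices-below D = length-filter (λ X → L M X ∧ (rank M X ℕ.≡ᵇ 1) ∧ (X ≤ᵥ D))
    (λ X → r 1 X * 𝟙 (X ≼? D)) λ X → trans
      (cong (λ b → if b then 1ℤ else 0ℤ) (trans (sym (𝔹.∧-assoc (L M X) (rank M X ℕ.≡ᵇ 1) (X ≤ᵥ D)))
        (cong₂ _∧_ (face-does 1 X) (≤ᵥ-does X D))))
      (𝟙-× (face? 1 X) (X ≼? D))

  triangular⇔simplicial : Triangular ⇔ Simplicial M
  triangular⇔simplicial = mk⇔
    (λ t D cD p → ℤₚ.+-injective (trans (numVertices-below D) (t D (cD , p))))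
    (λ s D (cD , p) → trans (sym (numVertices-below D)) (cong ℤ.+_ (s D cD p)))

  balanced⇔simplicial : Balanced ⇔ Simplicial M
  balanced⇔simplicial = triangular⇔simplicial ⇔-∘ mk⇔ balanced⇒triangular triangular⇒balanced

  -- Once the Boolean tests are rewritten as decisions, each summand depends on three truth values
  -- only, and `truth` is the table.
  σ-product : ∀ i j Z → (σ M i · σ M j) Z ≡ ι (product i j Z)
  σ-product i j Z = sumℚ-concatMap _ (λ X → r i X * Count j (λ Y → 𝟙 ((X ∘ᵥ Y) ≟ Z))) λ X → trans
    (sumℚ-map _ (λ Y → r i X * (r j Y * 𝟙 ((X ∘ᵥ Y) ≟ Z))) λ Y → trans
      (cong₂ (λ b d → if d then (if b then 1ℚ else 0ℚ) ℚ.* σ M j Y else 0ℚ)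
        (face-does i X) (==ᵥ-does (X ∘ᵥ Y) Z))
      (trans (cong (λ c → if does ((X ∘ᵥ Y) ≟ Z) then
                (if does (face? i X) then 1ℚ else 0ℚ) ℚ.* (if c then 1ℚ else 0ℚ) else 0ℚ) (face-does j Y))
        (truth (does (face? i X)) (does (face? j Y)) (does ((X ∘ᵥ Y) ≟ Z)))))
    (cong ι (∑-*ˡ (r i X) (λ Y → r j Y * 𝟙 ((X ∘ᵥ Y) ≟ Z))))
    where
    truth : ∀ b c d → (if d then (if b then 1ℚ else 0ℚ) ℚ.* (if c then 1ℚ else 0ℚ) else 0ℚ) ≡
      ι ((if b then 1ℤ else 0ℤ) * ((if c then 1ℤ else 0ℤ) * (if d then 1ℤ else 0ℤ)))
    truth false false false = refl
    truth false false true  = refl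
    truth false true  false = refl
    truth false true  true  = refl
    truth true  false false = refl
    truth true  false true  = refl
    truth true  true  false = refl
    truth true  true  true  = refl

  σ-commute : ∀ i j → ((σ M i · σ M j) ≈ₐ (σ M j · σ M i)) ⇔ Commute i j
  σ-commute i j = mk⇔
    (λ h Z → ι-injective (trans (sym (σ-product i j Z)) (trans (h Z) (σ-product j i Z))))
    (λ h Z → trans (σ-product i j Z) (trans (cong ι (h Z)) (sym (σ-product j i Z))))

theorem8p6 : ∀ {n : ℕ} (M : OrientedMatroid n) → HasRank M 3 →
    (((σ M 1 · σ M 2) ≈ₐ (σ M 2 · σ M 1)) ⇔ Simplicial M) ×
    (((σ M 1 · σ M 3) ≈ₐ (σ M 3 · σ M 1)) ⇔ Simplicial M) ×
    (((σ M 2 · σ M 3) ≈ₐ (σ M 3 · σ M 2)) ⇔ Simplicial M)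
theorem8p6 M hasRank =
  balanced⇔simplicial ⇔-∘ (commute-12⇔balanced ⇔-∘ σ-commute 1 2) ,
  balanced⇔simplicial ⇔-∘ (commute-23⇔balanced ⇔-∘ (commute-13⇔23 ⇔-∘ σ-commute 1 3)) ,
  balanced⇔simplicial ⇔-∘ (commute-23⇔balanced ⇔-∘ σ-commute 2 3)
  where
  open Products M hasRank
  open DoubleCounting M hasRank
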